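{- Let $\mathbb{K}$ be a field of characteristic zero. For every positive integer $n$, $\beta(\mathcal{I}_n)\ge\left\lfloor\frac n2\right\rfloor$.
   Context: Let $\mathbb{K}[x_{\{i,j\}}]$ be the polynomial ring in $\binom n2$ variables indexed by the pairs $\{i,j\}$, $1\le i<j\le n$. The symmetric group $\mathfrak{S}_n$ acts on it by $\sigma\cdot x_{\{i,j\}}=x_{\{\sigma(i),\sigma(j)\}}$, and $\mathcal{I}_n:=\mathbb{K}[x_{\{i,j\}}]^{\mathfrak{S}_n}$. $\beta(\mathcal{I}_n)$ denotes the smallest integer $d$ such that $\mathcal{I}_n$ is generated as a $\mathbb{K}$-algebra by its invariants of degree at most $d$. -}

module Defs where

open import Level using (Level; _⊔_)
open import Algebra.Apartness.Bundles using (HeytingField; HeytingCommutativeRing)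
open import Algebra.Bundles using (CommutativeRing)
import Algebra.Properties.Monoid.Mult as Mult
open import Data.Fin.Base using (Fin; _<_)
open import Data.Fin.Permutation using (Permutation′; _⟨$⟩ʳ_)
import Data.Fin.Properties as Fin
open import Data.List.Base using (List; []; _∷_; _++_; length; map; cartesianProductWith)
import Data.List.Membership.DecPropositional as DecMembership
open import Data.List.Membership.Propositional.Properties using (∈-∃++)
open import Data.List.Relation.Binary.Permutation.Propositional
  using (_↭_; ↭-refl; ↭-sym; ↭-trans; prep)
open import Data.List.Relation.Binary.Permutation.Propositional.Properties
  using (∈-resp-↭; ¬x∷xs↭[]; shift; drop-∷)
open import Data.List.Relation.Unary.Any using (here)
open import Data.Nat.Base as ℕ using (ℕ; suc)
open import Data.Product.Base using (_×_; _,_; map₂)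
open import Function.Base using (_∘_)
open import Function.Bundles using (Injection)
open import Function.Properties.Inverse using (↔⇒↣)
open import Relation.Binary.Definitions using (Decidable; DecidableEquality; tri<; tri≈; tri>)
open import Relation.Binary.PropositionalEquality using (_≡_; _≢_; refl; cong)
open import Relation.Nullary using (¬_; yes; no; contradiction)
open import Relation.Nullary.Decidable using (map′)

-- A classical field is a HeytingField with x # y taken to be ¬ (x ≈ y); 1 # 0 is
-- a consequence of the axioms.
CharacteristicZero : ∀ {c ℓ₁ ℓ₂} → HeytingField c ℓ₁ ℓ₂ → Set ℓ₁
CharacteristicZero K = ∀ (m : ℕ) → ¬ (suc m ·ℕ 1# ≈ 0#)
  where
  open HeytingField K using (_≈_; 0#; 1#; heytingCommutativeRing)
  open CommutativeRing (HeytingCommutativeRing.commutativeRing heytingCommutativeRing)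
    using (+-monoid)
  open Mult +-monoid renaming (_×_ to _·ℕ_) using ()

-- The polynomial ring K[X] on a set X of variables.
module Polynomials {c ℓ₁ ℓ₂ x : Level} (K : HeytingField c ℓ₁ ℓ₂)
                   {X : Set x} (_≟_ : DecidableEquality X) where

  open HeytingField K using (Carrier; _≈_; 0#; _+_; _*_)
  open DecMembership _≟_ using (_∈?_)

  -- The list x₁ ∷ … ∷ x_k ∷ [] stands for the monomial x₁ ⋯ x_k; the order of the
  -- factors is irrelevant, so two lists denote the same monomial iff they are
  -- related by _↭_.
  Monomial : Set x
  Monomial = List X

  _↭?_ : Decidable (_↭_ {A = X})
  []       ↭? []       = yes ↭-refl
  []       ↭? (y ∷ ys) = no (¬x∷xs↭[] ∘ ↭-sym)
  (x ∷ xs) ↭? ys with x ∈? ys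
  ... | no  x∉ys = no λ p → x∉ys (∈-resp-↭ p (here refl))
  ... | yes x∈ys with ∈-∃++ x∈ys
  ...   | as , bs , refl =
    map′ (λ p → ↭-trans (prep x p) (↭-sym (shift x as bs)))
         (λ p → drop-∷ (↭-trans p (shift x as bs)))
         (xs ↭? (as ++ bs))

  -- A polynomial is a formal sum of terms a · m, possibly with repeated monomials
  -- and zero coefficients; the equality of the ring K[X] is _≋_ below.
  Poly : Set (c ⊔ x)
  Poly = List (Carrier × Monomial)

  coeff : Poly → Monomial → Carrier
  coeff []            m = 0#
  coeff ((a , m′) ∷ p) m with m′ ↭? m
  ... | yes _ = a + coeff p m
  ... | no  _ = coeff p m

  infix 4 _≋_
  _≋_ : Poly → Poly → Set (ℓ₁ ⊔ x)
  p ≋ q = ∀ m → coeff p m ≈ coeff q m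

  const : Carrier → Poly
  const a = (a , []) ∷ []

  infixl 6 _⊕_
  _⊕_ : Poly → Poly → Poly
  _⊕_ = _++_

  infixl 7 _⊗_
  _⊗_ : Poly → Poly → Poly
  _⊗_ = cartesianProductWith λ { (a , m) (b , m′) → a * b , m ++ m′ }

  -- The K-algebra endomorphism of K[X] sending each variable x to φ x.
  rename : (X → X) → Poly → Poly
  rename φ = map (map₂ (map φ))

  -- p is a sum of monomials of degree ≤ d (so the zero polynomial qualifies).
  DegreeAtMost : ℕ → Poly → Set (ℓ₁ ⊔ x)
  DegreeAtMost d p = ∀ m → d ℕ.< length m → coeff p m ≈ 0#

  -- The K-subalgebra of K[X] generated by the polynomials satisfying S.
  data Adjoin {s} (S : Poly → Set s) : Poly → Set (c ⊔ ℓ₁ ⊔ x ⊔ s) where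
    generator : ∀ {p} → S p → Adjoin S p
    scalar    : ∀ a → Adjoin S (const a)
    plus      : ∀ {p q} → Adjoin S p → Adjoin S q → Adjoin S (p ⊕ q)
    times     : ∀ {p q} → Adjoin S p → Adjoin S q → Adjoin S (p ⊗ q)
    resp      : ∀ {p q} → p ≋ q → Adjoin S p → Adjoin S q

-- An unordered pair {i,j} of distinct elements is stored in increasing order.
record Pair (n : ℕ) : Set where
  constructor ⟪_,_,_⟫
  field
    lo hi : Fin n
    lo<hi : lo < hi

_≟ᴾ_ : ∀ {n} → DecidableEquality (Pair n)
⟪ i , j , i<j ⟫ ≟ᴾ ⟪ k , l , k<l ⟫ with i Fin.≟ k | j Fin.≟ l
... | yes refl | yes refl = yes (cong ⟪ i , j ,_⟫ (Fin.<-irrelevant i<j k<l))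
... | no i≢k   | _        = no (i≢k ∘ cong Pair.lo)
... | yes _    | no j≢l   = no (j≢l ∘ cong Pair.hi)

pair : ∀ {n} (i j : Fin n) → i ≢ j → Pair n
pair i j i≢j with Fin.<-cmp i j
... | tri< i<j _ _ = ⟪ i , j , i<j ⟫
... | tri≈ _ i≡j _ = contradiction i≡j i≢j
... | tri> _ _ j<i = ⟪ j , i , j<i ⟫

permute : ∀ {n} → Permutation′ n → Pair n → Pair n
permute σ ⟪ i , j , i<j ⟫ =
  pair (σ ⟨$⟩ʳ i) (σ ⟨$⟩ʳ j) (Fin.<⇒≢ i<j ∘ Injection.injective (↔⇒↣ σ))

module GraphInvariants {c ℓ₁ ℓ₂ : Level} (K : HeytingField c ℓ₁ ℓ₂) (n : ℕ) where

  open Polynomials K (_≟ᴾ_ {n}) public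

  _∙_ : Permutation′ n → Poly → Poly
  σ ∙ p = rename (permute σ) p

  Invariant : Poly → Set ℓ₁
  Invariant p = ∀ (σ : Permutation′ n) → σ ∙ p ≋ p

  GeneratedInDegreeAtMost : ℕ → Set (c ⊔ ℓ₁)
  GeneratedInDegreeAtMost d =
    ∀ p → Invariant p → Adjoin (λ q → Invariant q × DegreeAtMost d q) p

  -- d = β(𝓘ₙ).
  record IsBeta (d : ℕ) : Set (c ⊔ ℓ₁) where
    field
      generated : GeneratedInDegreeAtMost d
      smallest  : ∀ e → GeneratedInDegreeAtMost e → d ℕ.≤ e

{-# OPTIONS --safe #-}
module Submission where

open import Defs
open import Level using (Level; _⊔_)
open import Algebra.Apartness.Bundles using (HeytingField; HeytingCommutativeRing)
open import Algebra.Bundles using (CommutativeRing)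
import Algebra.Module.Construct.Idealization as Idealization
import Algebra.Module.Construct.TensorUnit as TensorUnit
open import Algebra.Morphism.Structures using (IsRingHomomorphism)
open import Data.Bool.Base using (if_then_else_)
open import Data.Fin.Base using (Fin; zero; suc; toℕ; punchOut)
open import Data.Fin.Permutation using (Permutation′; permutation; _⟨$⟩ʳ_)
import Data.Fin.Properties as Fin
open import Data.List.Base using (List; []; _∷_; _++_; length; filter; map; replicate)
import Data.List.Properties as List
open import Data.List.Relation.Binary.Permutation.Propositional
  as ↭ using (_↭_; ↭-refl; ↭-sym; ↭-trans)
open import Data.List.Relation.Binary.Permutation.Propositional.Properties using (↭-length)
open import Data.List.Relation.Unary.All using (All; []; _∷_)
open import Data.List.Relation.Unary.All.Properties using (all-filter)
open import Data.Nat.Base as ℕ using (ℕ; zero; suc; s≤s; NonZero; ⌊_/2⌋; _≤_; _!)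
open import Data.Nat.ListAction using (sum)
import Data.Nat.Properties as ℕ
open import Data.Nat.Properties using (_!≢0)
open import Data.Product.Base using (∃; _×_; _,_; proj₁; proj₂; map₂)
open import Data.Sum.Base using (_⊎_; inj₁; inj₂)
open import Data.Vec.Base as Vec using (Vec; []; _∷_; lookup; toList)
import Data.Vec.Functional as Vector
open import Function.Base using (_∘_)
open import Function.Bundles using (Injection)
open import Function.Definitions using (Injective)
open import Function.Properties.Inverse using (↔⇒↣)
open import Relation.Binary.Definitions using (DecidableEquality; tri<; tri≈; tri>)
open import Relation.Binary.PropositionalEquality as ≡ using (_≡_; _≢_)
open import Relation.Nullary using (¬_; does; yes; no; contradiction; ¬?)
import Relation.Unary as Unary

-- Write k = ⌊n/2⌋ and substitute z_i z_j for x_{ij}, where z_i = i + v_i ε lies in the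
-- dual numbers K[ε] and v consists of the signed binomial coefficients of the finite
-- difference of order 2k − 1.  The ε-part of the power sum z_1^e + ⋯ + z_n^e is e times
-- the (2k − 1)-st difference of x^{e−1}: it vanishes for e < 2k but is (2k)! for e = 2k.
-- An invariant of degree d < k becomes, after averaging over all permutations, a
-- combination of sums of z_{i₁}^{e₁} ⋯ z_{i_n}^{e_n} over distinct i₁, …, i_n with
-- e₁ + ⋯ + e_n ≤ 2d, and these are polynomials in the power sums of exponent ≤ 2d.  So
-- the values of the subalgebra generated by the invariants of degree < k have no ε-part.
-- But the invariant Σ_{i≠j} x_{ij}^k takes the value p_k² − p_{2k}, which has one.

-- Sums over tuples of distinct indices

module InjectiveSums {c ℓ} (R : CommutativeRing c ℓ) where

  open CommutativeRing R hiding (zero)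
  open import Algebra.Properties.Semiring.Sum semiring renaming (sum to ∑)
  open import Algebra.Properties.CommutativeSemiring.Exp commutativeSemiring
  open import Algebra.Properties.Semiring.Mult semiring renaming (_×_ to _·_)
  open import Algebra.Properties.Group +-group using (∙-cancelʳ)
  open import Algebra.Properties.CommutativeSemigroup *-commutativeSemigroup using (interchange)
  import Algebra.Solver.Ring.NaturalCoefficients.Default commutativeSemiring as Solver
  open Solver using (_:+_; _:*_; _:=_)
  open import Relation.Binary.Reasoning.Setoid setoid

  -- One summand is traded for another without subtraction, so the semiring solver suffices. This
  -- handles the diagonal term j = i in `injSum-split` and in the sum of edge powers.
  ∑-differ-at : ∀ {n} (i : Fin n) (f g : Fin n → Carrier) →
                (∀ j → j ≢ i → f j ≈ g j) → ∑ f + g i ≈ ∑ g + f i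
  ∑-differ-at {suc n} zero f g f≈g = begin
    f zero + ∑ (f ∘ suc) + g zero  ≈⟨ +-congʳ (+-congˡ (sum-cong-≋ λ j → f≈g (suc j) λ ())) ⟩
    f zero + ∑ (g ∘ suc) + g zero  ≈⟨ Solver.solve 3 (λ a b c → (a :+ b) :+ c := (c :+ b) :+ a) refl _ _ _ ⟩
    g zero + ∑ (g ∘ suc) + f zero  ∎
  ∑-differ-at {suc n} (suc i) f g f≈g = begin
    f zero + ∑ (f ∘ suc) + g (suc i)    ≈⟨ +-assoc _ _ _ ⟩
    f zero + (∑ (f ∘ suc) + g (suc i))  ≈⟨ +-cong (f≈g zero λ ()) (∑-differ-at i (f ∘ suc) (g ∘ suc)
                                             λ j j≢i → f≈g (suc j) (j≢i ∘ Fin.suc-injective)) ⟩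
    g zero + (∑ (g ∘ suc) + f (suc i))  ≈⟨ +-assoc _ _ _ ⟨
    g zero + ∑ (g ∘ suc) + f (suc i)    ∎

  ∑-zero : ∀ {n} (f : Fin n → Carrier) → (∀ i → f i ≈ 0#) → ∑ f ≈ 0#
  ∑-zero {n} f f≈0 = trans (sum-cong-≋ f≈0) (sum-replicate-zero n)

  -- The sum of f e es′ over the ways of picking an entry e of a list and leaving es′.
  pickSum : (ℕ → List ℕ → Carrier) → List ℕ → Carrier
  pickSum f []       = 0#
  pickSum f (e ∷ es) = f e es + pickSum (λ e′ es′ → f e′ (e ∷ es′)) es

  pickSum-cong : ∀ {f g} → (∀ e es → f e es ≈ g e es) → ∀ es → pickSum f es ≈ pickSum g es
  pickSum-cong f≈g []       = refl
  pickSum-cong f≈g (e ∷ es) = +-cong (f≈g e es) (pickSum-cong (λ e′ es′ → f≈g e′ (e ∷ es′)) es)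

  *-distribˡ-pickSum : ∀ x f es → x * pickSum f es ≈ pickSum (λ e es′ → x * f e es′) es
  *-distribˡ-pickSum x f []       = zeroʳ x
  *-distribˡ-pickSum x f (e ∷ es) = trans (distribˡ _ _ _) (+-congˡ (*-distribˡ-pickSum x _ es))

  ∑-pickSum-comm : ∀ {n} (f : Fin n → ℕ → List ℕ → Carrier) es →
                   ∑[ i < n ] (pickSum (f i) es) ≈ pickSum (λ e es′ → ∑[ i < n ] f i e es′) es
  ∑-pickSum-comm {n} f []       = sum-replicate-zero n
  ∑-pickSum-comm {n} f (e ∷ es) = trans (∑-distrib-+ (λ i → f i e es) _)
    (+-congˡ (∑-pickSum-comm {n} (λ i e′ es′ → f i e′ (e ∷ es′)) es))

  pickSum-replicate : ∀ f l x → pickSum f (replicate (suc l) x) ≈ suc l · f x (replicate l x)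
  pickSum-replicate f zero    x = refl
  pickSum-replicate f (suc l) x = +-congˡ (pickSum-replicate (λ e es → f e (x ∷ es)) l x)

  module _ {n : ℕ} where

    -- Distinctness is a 0/1 factor in the ring rather than a restriction of the index set, so every
    -- sum runs over all of `Fin n`.
    distinct : Fin n → Fin n → Carrier
    distinct i j = if does (i Fin.≟ j) then 0# else 1#

    distinct-refl : ∀ i → distinct i i ≈ 0#
    distinct-refl i with i Fin.≟ i
    ... | yes _  = refl
    ... | no i≢i = contradiction ≡.refl i≢i

    distinct-≢ : ∀ {i j} → i ≢ j → distinct i j ≈ 1#
    distinct-≢ {i} {j} i≢j with i Fin.≟ j
    ... | yes i≡j = contradiction i≡j i≢j
    ... | no  _   = refl

    distinct-sym : ∀ i j → distinct i j ≈ distinct j i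
    distinct-sym i j with i Fin.≟ j
    ... | yes ≡.refl = sym (distinct-refl i)
    ... | no  i≢j    = sym (distinct-≢ (i≢j ∘ ≡.sym))

    infixl 8 _∖_
    _∖_ : (Fin n → Carrier) → Fin n → (Fin n → Carrier)
    (u ∖ i) j = u j * distinct i j

    ∖-comm : ∀ u i j k → (u ∖ i ∖ j) k ≈ (u ∖ j ∖ i) k
    ∖-comm u i j k = Solver.solve 3 (λ a b c → (a :* b) :* c := (a :* c) :* b) refl _ _ _

    ∖-idem : ∀ u i k → (u ∖ i ∖ i) k ≈ (u ∖ i) k
    ∖-idem u i k with i Fin.≟ k
    ... | yes _ = trans (*-congʳ (zeroʳ _)) (trans (zeroˡ _) (sym (zeroʳ _)))
    ... | no  _ = *-identityʳ _

    everything : Fin n → Carrier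
    everything _ = 1#

    module _ (z : Fin n → Carrier) where

      -- The sum of z i₁ ^ e₁ ⋯ z i_l ^ e_l over the pairwise distinct i₁, …, i_l; in the
      -- recursion u is the weight (0 or 1) of the indices not yet used.
      injSum : (Fin n → Carrier) → List ℕ → Carrier
      injSum u []       = 1#
      injSum u (e ∷ es) = ∑[ i < n ] (u i * z i ^ e * injSum (u ∖ i) es)

      powerSum : ℕ → Carrier
      powerSum e = ∑[ i < n ] (z i ^ e)

      injSum-cong : ∀ {u v} → (∀ i → u i ≈ v i) → ∀ es → injSum u es ≈ injSum v es
      injSum-cong u≈v []       = refl
      injSum-cong u≈v (e ∷ es) = sum-cong-≋ λ i →
        *-cong (*-congʳ (u≈v i)) (injSum-cong (λ j → *-congʳ (u≈v j)) es)

      -- Either no factor sits at the index i, or exactly one of them does.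
      injSum-split : ∀ u i es →
        injSum u es ≈ injSum (u ∖ i) es + pickSum (λ e es′ → u i * z i ^ e * injSum (u ∖ i) es′) es
      injSum-split u i []       = sym (+-identityʳ 1#)
      injSum-split u i (e ∷ es) = begin
        ∑[ j < n ] (u j * z j ^ e * injSum (u ∖ j) es)
          ≈⟨ sum-cong-≋ (λ j → trans (*-congˡ (injSum-split (u ∖ j) i es)) (distribˡ _ _ _)) ⟩
        ∑[ j < n ] (f j + u j * z j ^ e * pickSum (λ e′ es′ → (u ∖ j) i * z i ^ e′ * injSum (u ∖ j ∖ i) es′) es)
          ≈⟨ ∑-distrib-+ f _ ⟩
        ∑ f + ∑[ j < n ] (u j * z j ^ e * pickSum (λ e′ es′ → (u ∖ j) i * z i ^ e′ * injSum (u ∖ j ∖ i) es′) es)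
          ≈⟨ +-cong ∑f≈ (sum-cong-≋ λ j → trans (*-distribˡ-pickSum _ _ es) (pickSum-cong (move j) es)) ⟩
        ∑ g + u i * z i ^ e * injSum (u ∖ i) es +
          ∑[ j < n ] (pickSum (λ e′ es′ → u i * z i ^ e′ * ((u ∖ i) j * z j ^ e * injSum (u ∖ i ∖ j) es′)) es)
          ≈⟨ +-congˡ (∑-pickSum-comm {n} _ es) ⟩
        ∑ g + u i * z i ^ e * injSum (u ∖ i) es +
          pickSum (λ e′ es′ → ∑[ j < n ] (u i * z i ^ e′ * ((u ∖ i) j * z j ^ e * injSum (u ∖ i ∖ j) es′))) es
          ≈⟨ +-congˡ (pickSum-cong (λ e′ es′ → sym (*-distribˡ-sum {n} _ _)) es) ⟩
        ∑ g + u i * z i ^ e * injSum (u ∖ i) es +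
          pickSum (λ e′ es′ → u i * z i ^ e′ * injSum (u ∖ i) (e ∷ es′)) es
          ≈⟨ +-assoc _ _ _ ⟩
        ∑ g + (u i * z i ^ e * injSum (u ∖ i) es + pickSum (λ e′ es′ → u i * z i ^ e′ * injSum (u ∖ i) (e ∷ es′)) es) ∎
        where
        f g : Fin n → Carrier
        f j = u j * z j ^ e * injSum (u ∖ j ∖ i) es
        g j = (u ∖ i) j * z j ^ e * injSum (u ∖ i ∖ j) es

        -- The factor `distinct i i` kills the term j = i of `g`; the same term of `f` is the
        -- contribution of placing `e` itself at `i`.
        gi≈0 : g i ≈ 0#
        gi≈0 = trans (*-congʳ (trans (*-congʳ (trans (*-congˡ (distinct-refl i)) (zeroʳ _))) (zeroˡ _))) (zeroˡ _)

        unused : ∀ j → j ≢ i → u j ≈ (u ∖ i) j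
        unused j j≢i = trans (sym (*-identityʳ _)) (*-congˡ (sym (distinct-≢ (j≢i ∘ ≡.sym))))

        ∑f≈ : ∑ f ≈ ∑ g + u i * z i ^ e * injSum (u ∖ i) es
        ∑f≈ = begin
          ∑ f                                       ≈⟨ +-identityʳ _ ⟨
          ∑ f + 0#                                  ≈⟨ +-congˡ gi≈0 ⟨
          ∑ f + g i                                 ≈⟨ ∑-differ-at i f g (λ j j≢i → *-cong (*-congʳ (unused j j≢i)) (injSum-cong (∖-comm u j i) es)) ⟩
          ∑ g + f i                                 ≈⟨ +-congˡ (*-congˡ (injSum-cong (∖-idem u i) es)) ⟩
          ∑ g + u i * z i ^ e * injSum (u ∖ i) es  ∎

        -- Exchanging the roles of `i` and `j` preserves the summand, since `distinct` is symmetric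
        -- and removals commute.
        move : ∀ j e′ es′ → u j * z j ^ e * ((u ∖ j) i * z i ^ e′ * injSum (u ∖ j ∖ i) es′) ≈
                            u i * z i ^ e′ * ((u ∖ i) j * z j ^ e * injSum (u ∖ i ∖ j) es′)
        move j e′ es′ = begin
          u j * z j ^ e * (u i * distinct j i * z i ^ e′ * injSum (u ∖ j ∖ i) es′)
            ≈⟨ *-congˡ (*-cong (*-congʳ (*-congˡ (distinct-sym j i))) (injSum-cong (∖-comm u j i) es′)) ⟩
          u j * z j ^ e * (u i * distinct i j * z i ^ e′ * injSum (u ∖ i ∖ j) es′)
            ≈⟨ Solver.solve 6 (λ a b c d p q →
                 (a :* b) :* (((c :* d) :* p) :* q) := (c :* p) :* (((a :* d) :* b) :* q))
                 refl _ _ _ _ _ _ ⟩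
          u i * z i ^ e′ * (u j * distinct i j * z j ^ e * injSum (u ∖ i ∖ j) es′) ∎

      -- In the product on the right, the index chosen by the power sum either avoids the indices of
      -- all other factors or coincides with exactly one of them, whose exponent `e′` then becomes
      -- `e + e′`.
      injSum-∷ : ∀ e es →
        injSum everything (e ∷ es) + pickSum (λ e′ es′ → injSum everything (e ℕ.+ e′ ∷ es′)) es ≈
        powerSum e * injSum everything es
      injSum-∷ e es = begin
        ∑ f + pickSum (λ e′ es′ → injSum everything (e ℕ.+ e′ ∷ es′)) es
          ≈⟨ +-congˡ (pickSum-cong (λ e′ es′ → sum-cong-≋ {n} λ i → merge i e′ es′) es) ⟩
        ∑ f + pickSum (λ e′ es′ → ∑[ i < n ] (z i ^ e * (1# * z i ^ e′ * injSum (everything ∖ i) es′))) es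
          ≈⟨ +-congˡ (∑-pickSum-comm {n} _ es) ⟨
        ∑ f + ∑[ i < n ] (pickSum (λ e′ es′ → z i ^ e * (1# * z i ^ e′ * injSum (everything ∖ i) es′)) es)
          ≈⟨ ∑-distrib-+ f _ ⟨
        ∑[ i < n ] (f i + pickSum (λ e′ es′ → z i ^ e * (1# * z i ^ e′ * injSum (everything ∖ i) es′)) es)
          ≈⟨ sum-cong-≋ (λ i → collect i) ⟩
        ∑[ i < n ] (z i ^ e * injSum everything es)
          ≈⟨ *-distribʳ-sum {n} _ _ ⟨
        powerSum e * injSum everything es ∎
        where
        f : Fin n → Carrier
        f i = 1# * z i ^ e * injSum (everything ∖ i) es

        merge : ∀ i e′ es′ → 1# * z i ^ (e ℕ.+ e′) * injSum (everything ∖ i) es′ ≈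
                             z i ^ e * (1# * z i ^ e′ * injSum (everything ∖ i) es′)
        merge i e′ es′ = trans (*-congʳ (*-congˡ (^-homo-* (z i) e e′)))
          (Solver.solve 4 (λ o a b c → (o :* (a :* b)) :* c := a :* ((o :* b) :* c)) refl _ _ _ _)

        collect : ∀ i → f i + pickSum (λ e′ es′ → z i ^ e * (1# * z i ^ e′ * injSum (everything ∖ i) es′)) es ≈
                        z i ^ e * injSum everything es
        collect i = begin
          f i + pickSum (λ e′ es′ → z i ^ e * (1# * z i ^ e′ * injSum (everything ∖ i) es′)) es
            ≈⟨ +-cong (*-congʳ (*-identityˡ _)) (sym (*-distribˡ-pickSum _ _ es)) ⟩
          z i ^ e * injSum (everything ∖ i) es + z i ^ e * pickSum (λ e′ es′ → 1# * z i ^ e′ * injSum (everything ∖ i) es′) es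
            ≈⟨ distribˡ _ _ _ ⟨
          z i ^ e * (injSum (everything ∖ i) es + pickSum (λ e′ es′ → 1# * z i ^ e′ * injSum (everything ∖ i) es′) es)
            ≈⟨ *-congˡ (injSum-split everything i es) ⟨
          z i ^ e * injSum everything es ∎

      -- The value counts injective l-tuples; only its being a positive integer matters. By
      -- `injSum-∷` with exponent 0, the sum S for one more index satisfies S + l G = n G, and n - l
      -- is `suc r`.
      injSum-zeros : ∀ l r → l ℕ.+ r ≡ n → ∃ λ m → injSum everything (replicate l 0) ≈ suc m · 1#
      injSum-zeros zero    r _    = 0 , sym (+-identityʳ 1#)
      injSum-zeros (suc l) r l+r≡n
        with m , IH ← injSum-zeros l (suc r) (≡.trans (ℕ.+-suc l r) l+r≡n)
        -- The successor of this witness is `suc r * suc m` by definition.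
        = m ℕ.+ r ℕ.* suc m , (begin
          injSum everything (0 ∷ replicate l 0) ≈⟨ ∙-cancelʳ (l · G) _ _ (trans (+-congˡ (sym (picks l)))
                                                     (trans (injSum-∷ 0 (replicate l 0)) (sym expand))) ⟩
          suc r · G                       ≈⟨ ×-congʳ (suc r) IH ⟩
          suc r · (suc m · 1#)            ≈⟨ ×-assocˡ 1# (suc r) (suc m) ⟩
          (suc r ℕ.* suc m) · 1#          ∎)
        where
        G = injSum everything (replicate l 0)

        picks : ∀ l → pickSum (λ e′ es′ → injSum everything (0 ℕ.+ e′ ∷ es′)) (replicate l 0) ≈
                      l · injSum everything (replicate l 0)
        picks zero    = refl
        picks (suc l) = pickSum-replicate (λ e es → injSum everything (e ∷ es)) l 0

        expand : suc r · G + l · G ≈ powerSum 0 * G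
        expand = begin
          suc r · G + l · G  ≈⟨ ×-homo-+ G (suc r) l ⟨
          (suc r ℕ.+ l) · G  ≈⟨ ×-congˡ (≡.trans (ℕ.+-comm (suc r) l) (≡.trans (ℕ.+-suc l r) l+r≡n)) ⟩
          n · G              ≈⟨ ×-congʳ n (*-identityˡ G) ⟨
          n · (1# * G)       ≈⟨ ×-assoc-* n 1# G ⟨
          n · 1# * G         ≈⟨ *-congʳ (sum-replicate n) ⟨
          powerSum 0 * G     ∎

    -- Sums over vectors of indices

    vecSum : ∀ {l} → (Vec (Fin n) l → Carrier) → Carrier
    vecSum {zero}  F = F []
    vecSum {suc l} F = ∑[ i < n ] vecSum (λ v → F (i ∷ v))

    vecSum-cong : ∀ {l} {F G : Vec (Fin n) l → Carrier} → (∀ v → F v ≈ G v) → vecSum F ≈ vecSum G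
    vecSum-cong {zero}  F≈G = F≈G []
    vecSum-cong {suc l} F≈G = sum-cong-≋ λ i → vecSum-cong λ v → F≈G (i ∷ v)

    *-distribˡ-vecSum : ∀ {l} x (F : Vec (Fin n) l → Carrier) → x * vecSum F ≈ vecSum (λ v → x * F v)
    *-distribˡ-vecSum {zero}  x F = refl
    *-distribˡ-vecSum {suc l} x F = trans (*-distribˡ-sum {n} x _) (sum-cong-≋ λ i → *-distribˡ-vecSum x λ v → F (i ∷ v))

    vecSum-+ : ∀ {l} (F G : Vec (Fin n) l → Carrier) → vecSum (λ v → F v + G v) ≈ vecSum F + vecSum G
    vecSum-+ {zero}  F G = refl
    vecSum-+ {suc l} F G = trans (sum-cong-≋ λ i → vecSum-+ (λ v → F (i ∷ v)) λ v → G (i ∷ v))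
      (∑-distrib-+ (λ i → vecSum λ v → F (i ∷ v)) _)

    vecSum-zero : ∀ {l} (F : Vec (Fin n) l → Carrier) → (∀ v → F v ≈ 0#) → vecSum F ≈ 0#
    vecSum-zero {zero}  F F≈0 = F≈0 []
    vecSum-zero {suc l} F F≈0 = ∑-zero {n} _ λ i → vecSum-zero (λ v → F (i ∷ v)) λ v → F≈0 (i ∷ v)

    -- weight everything v is 1 or 0 according to whether v is injective.
    weight : ∀ {l} → (Fin n → Carrier) → Vec (Fin n) l → Carrier
    weight u []      = 1#
    weight u (i ∷ v) = u i * weight (u ∖ i) v

    weight-used : ∀ {l} u (v : Vec (Fin n) l) j → u (lookup v j) ≈ 0# → weight u v ≈ 0#
    weight-used u (i ∷ v) zero    ui≈0 = trans (*-congʳ ui≈0) (zeroˡ _)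
    weight-used u (i ∷ v) (suc j) uv≈0 =
      trans (*-congˡ (weight-used (u ∖ i) v j (trans (*-congʳ uv≈0) (zeroˡ _)))) (zeroʳ _)

    -- A repeated index is removed from the weight at its first occurrence, so a later occurrence
    -- contributes a zero factor. Hence only permutations survive in `average`.
    weight-injective : ∀ {l} u (v : Vec (Fin n) l) → weight u v ≈ 0# ⊎ Injective _≡_ _≡_ (lookup v)
    weight-injective u []      = inj₂ λ { {()} }
    weight-injective u (i ∷ v) with Fin.any? (λ j → i Fin.≟ lookup v j) | weight-injective (u ∖ i) v
    ... | yes (j , i≡vj) | _ = inj₁ (trans (*-congˡ (weight-used (u ∖ i) v j
            (trans (*-congˡ (trans (reflexive (≡.cong (distinct i) (≡.sym i≡vj))) (distinct-refl i))) (zeroʳ _)))) (zeroʳ _))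
    ... | no _    | inj₁ w≈0   = inj₁ (trans (*-congˡ w≈0) (zeroʳ _))
    ... | no i∉v  | inj₂ v-inj = inj₂ λ {j} {k} → ∷-injective j k
      where
      ∷-injective : ∀ j k → lookup (i ∷ v) j ≡ lookup (i ∷ v) k → j ≡ k
      ∷-injective zero    zero    _  = ≡.refl
      ∷-injective zero    (suc k) eq = contradiction (k , eq) i∉v
      ∷-injective (suc j) zero    eq = contradiction (j , ≡.sym eq) i∉v
      ∷-injective (suc j) (suc k) eq = ≡.cong suc (v-inj eq)

  power : ∀ {l} → (Fin l → Carrier) → Vec ℕ l → Carrier
  power y []       = 1#
  power y (e ∷ es) = y zero ^ e * power (y ∘ suc) es

  power-zeros : ∀ {l} (y : Fin l → Carrier) → power y (Vec.replicate l 0) ≈ 1#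
  power-zeros {zero}  y = refl
  power-zeros {suc l} y = trans (*-identityˡ _) (power-zeros (y ∘ suc))

  power-suc : ∀ {l} (y : Fin l → Carrier) es j → power y (Vec.updateAt es j suc) ≈ y j * power y es
  power-suc y (e ∷ es) zero    = *-assoc _ _ _
  power-suc y (e ∷ es) (suc j) = trans (*-congˡ (power-suc (y ∘ suc) es j))
    (Solver.solve 3 (λ a b c → a :* (b :* c) := b :* (a :* c)) refl _ _ _)

  -- The recursive form suits the reduction to power sums, the vector form the averaging over
  -- permutations.
  injSum≈vecSum : ∀ {n l} (z : Fin n → Carrier) u (es : Vec ℕ l) →
                  injSum z u (toList es) ≈ vecSum (λ v → weight u v * power (z ∘ lookup v) es)
  injSum≈vecSum z u []       = sym (*-identityˡ 1#)
  injSum≈vecSum {n} z u (e ∷ es) = sum-cong-≋ {n} λ i → begin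
    u i * z i ^ e * injSum z (u ∖ i) (toList es)
      ≈⟨ *-congˡ (injSum≈vecSum z (u ∖ i) es) ⟩
    u i * z i ^ e * vecSum (λ v → weight (u ∖ i) v * power (z ∘ lookup v) es)
      ≈⟨ *-distribˡ-vecSum (u i * z i ^ e) (λ v → weight (u ∖ i) v * power (z ∘ lookup v) es) ⟩
    vecSum (λ v → u i * z i ^ e * (weight (u ∖ i) v * power (z ∘ lookup v) es))
      ≈⟨ vecSum-cong (λ v → interchange (u i) (z i ^ e) (weight (u ∖ i) v) (power (z ∘ lookup v) es)) ⟩
    vecSum (λ v → u i * weight (u ∖ i) v * (z i ^ e * power (z ∘ lookup v) es)) ∎

  -- Proving membership in a subring avoids writing down the polynomial in the power sums that
  -- equals a given `injSum`.
  record IsSubring {p} (P : Carrier → Set p) : Set (c ⊔ ℓ ⊔ p) where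
    field
      P-resp : ∀ {x y} → x ≈ y → P x → P y
      P-0    : P 0#
      P-1    : P 1#
      P-+    : ∀ {x y} → P x → P y → P (x + y)
      P-*    : ∀ {x y} → P x → P y → P (x * y)
      P-neg  : ∀ {x} → P x → P (- x)

    P-cancelʳ : ∀ {x y} → P y → P (x + y) → P x
    P-cancelʳ {x} {y} Py Px+y = P-resp (begin
      x + y + - y    ≈⟨ +-assoc _ _ _ ⟩
      x + (y + - y)  ≈⟨ +-congˡ (-‿inverseʳ y) ⟩
      x + 0#         ≈⟨ +-identityʳ x ⟩
      x              ∎) (P-+ Px+y (P-neg Py))

    -- The two equations record that a pick shortens the list by one and, counting the picked entry,
    -- keeps the total exponent; the induction in `P-injSum` consumes both.
    P-pickSum : ∀ f es → (∀ e′ es′ → length es ≡ suc (length es′) → e′ ℕ.+ sum es′ ≡ sum es → P (f e′ es′)) →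
                P (pickSum f es)
    P-pickSum f []       Pf = P-0
    P-pickSum f (e ∷ es) Pf = P-+ (Pf e es ≡.refl ≡.refl) (P-pickSum _ es λ e′ es′ len total →
      Pf e′ (e ∷ es′) (≡.cong suc len) (≡.trans (x∙yz≈y∙xz e′ e (sum es′)) (≡.cong (e ℕ.+_) total)))
      where open import Algebra.Properties.CommutativeSemigroup ℕ.+-commutativeSemigroup using (x∙yz≈y∙xz)

    -- By injSum-∷, since its pickSum involves fewer factors of the same total degree.
    P-injSum : ∀ {n} (z : Fin n → Carrier) d → (∀ e → e ℕ.≤ d → P (powerSum z e)) →
               ∀ es → sum es ℕ.≤ d → P (injSum z everything es)
    P-injSum z d P-powerSum es = go (length es) es ≡.refl
      where
      -- The list `e + e′ ∷ es′` is not a tail of the given one, so the recursion runs on the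
      -- length.
      go : ∀ l es → length es ≡ l → sum es ℕ.≤ d → P (injSum z everything es)
      go zero    []       _   _ = P-1
      go (suc l) (e ∷ es) len total≤d = P-cancelʳ
        (P-pickSum _ es λ e′ es′ len′ total′ →
          go l (e ℕ.+ e′ ∷ es′) (≡.trans (≡.sym len′) (ℕ.suc-injective len))
            (≡.subst (ℕ._≤ d) (≡.trans (≡.cong (e ℕ.+_) (≡.sym total′)) (≡.sym (ℕ.+-assoc e e′ _))) total≤d))
        (P-resp (sym (injSum-∷ z e es))
          (P-* (P-powerSum e (ℕ.≤-trans (ℕ.m≤m+n e _) total≤d))
               (go l es (ℕ.suc-injective len) (ℕ.≤-trans (ℕ.m≤n+m _ e) total≤d))))

-- Finite differences and dual numbers

module FiniteDifferences {c ℓ} (A : CommutativeRing c ℓ) where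

  open CommutativeRing A hiding (zero)
  open import Algebra.Properties.Semiring.Sum semiring renaming (sum to ∑)
  open import Algebra.Properties.CommutativeSemiring.Exp commutativeSemiring
  open import Algebra.Properties.Semiring.Mult semiring renaming (_×_ to _·_)
  open import Algebra.Properties.Group +-group using (∙-cancelʳ)
  import Algebra.Solver.Ring.NaturalCoefficients.Default commutativeSemiring as Solver
  open Solver using (_:+_; _:*_; _:=_)
  open import Relation.Binary.Reasoning.Setoid setoid

  x-y+y≈x : ∀ x y → x + - y + y ≈ x
  x-y+y≈x x y = trans (+-assoc _ _ _) (trans (+-congˡ (-‿inverseˡ y)) (+-identityʳ x))

  Δ : ℕ → (ℕ → Carrier) → ℕ → Carrier
  Δ zero    g x = g x
  Δ (suc m) g x = Δ m g (suc x) + - Δ m g x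

  -- Combined with `∙-cancelʳ`, this form clears subtraction from the arguments below, which brings
  -- them within reach of the semiring solver.
  Δ-step : ∀ m g x → Δ (suc m) g x + Δ m g x ≈ Δ m g (suc x)
  Δ-step m g x = x-y+y≈x _ _

  Δ-shift : ∀ m g x → Δ m (g ∘ suc) x ≈ Δ m g (suc x)
  Δ-shift zero    g x = refl
  Δ-shift (suc m) g x = +-cong (Δ-shift m g (suc x)) (-‿cong (Δ-shift m g x))

  -- Of the Leibniz rule for a product only two terms remain, because the factor x has first
  -- difference 1 and vanishing higher differences.
  Δ-Leibniz : ∀ m g x → Δ (suc m) (λ i → i · 1# * g i) x ≈
              x · 1# * Δ (suc m) g x + suc m · 1# * Δ m g (suc x)
  Δ-Leibniz zero g x = ∙-cancelʳ (x · 1# * g x) _ _ (begin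
    Δ 1 (λ i → i · 1# * g i) x + x · 1# * g x
      ≈⟨ Δ-step 0 (λ i → i · 1# * g i) x ⟩
    (1# + x · 1#) * g (suc x)
      ≈⟨ split ⟩
    x · 1# * g (suc x) + (1# + 0#) * g (suc x)
      ≈⟨ +-congʳ (*-congˡ (Δ-step 0 g x)) ⟨
    x · 1# * (Δ 1 g x + g x) + (1# + 0#) * g (suc x)
      ≈⟨ Solver.solve 4 (λ X d a b → X :* (d :+ a) :+ b := (X :* d :+ b) :+ X :* a) refl _ (Δ 1 g x) (g x) _ ⟩
    x · 1# * Δ 1 g x + (1# + 0#) * g (suc x) + x · 1# * g x ∎)
    where
    split : (1# + x · 1#) * g (suc x) ≈ x · 1# * g (suc x) + (1# + 0#) * g (suc x)
    split = trans (*-congʳ (trans (+-comm _ _) (+-congˡ (sym (+-identityʳ 1#))))) (distribʳ _ _ _)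
  Δ-Leibniz (suc m) g x = ∙-cancelʳ (Δ (suc m) xg x) _ _ (begin
    Δ (suc (suc m)) xg x + Δ (suc m) xg x
      ≈⟨ Δ-step (suc m) xg x ⟩
    Δ (suc m) xg (suc x)
      ≈⟨ Δ-Leibniz m g (suc x) ⟩
    (1# + X) * D₁ (suc x) + c′ * Δ m g (suc (suc x))
      ≈⟨ +-cong (trans (distribʳ _ _ _) (+-congʳ (*-identityˡ _))) (*-congˡ (sym (Δ-step m g (suc x)))) ⟩
    D₁ (suc x) + X * D₁ (suc x) + c′ * (D₁ (suc x) + Δ m g (suc x))
      ≈⟨ +-congʳ (+-cong (sym (*-identityˡ _)) (*-congˡ (sym (Δ-step (suc m) g x)))) ⟩
    -- The inserted `1#` lets the solver collect `D₁ (suc x)` with coefficient `1# + c′`, which is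
    -- `suc (suc m) · 1#` by definition.
    1# * D₁ (suc x) + X * (Δ (suc (suc m)) g x + D₁ x) + c′ * (D₁ (suc x) + Δ m g (suc x))
      ≈⟨ Solver.solve 7 (λ o X′ C d₂ d₁ d₁′ d₀ →
           (o :* d₁′ :+ X′ :* (d₂ :+ d₁)) :+ C :* (d₁′ :+ d₀) :=
           (X′ :* d₂ :+ (o :+ C) :* d₁′) :+ (X′ :* d₁ :+ C :* d₀))
           refl 1# X c′ (Δ (suc (suc m)) g x) (D₁ x) (D₁ (suc x)) (Δ m g (suc x)) ⟩
    X * Δ (suc (suc m)) g x + (1# + c′) * D₁ (suc x) + (X * D₁ x + c′ * Δ m g (suc x))
      ≈⟨ +-congˡ (Δ-Leibniz m g x) ⟨
    X * Δ (suc (suc m)) g x + (1# + c′) * D₁ (suc x) + Δ (suc m) xg x ∎)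
    where
    xg : ℕ → Carrier
    xg i = i · 1# * g i
    X c′ : Carrier
    X  = x · 1#
    c′ = suc m · 1#
    D₁ : ℕ → Carrier
    D₁ = Δ (suc m) g

  Δ-const : ∀ m a x → Δ (suc m) (λ _ → a) x ≈ 0#
  Δ-const zero    a x = -‿inverseʳ a
  Δ-const (suc m) a x = trans (+-cong (Δ-const m a (suc x)) (-‿cong (Δ-const m a x))) (-‿inverseʳ 0#)

  -- Differencing lowers the degree: `Δ-Leibniz` removes one factor x, and both resulting
  -- differences still have order greater than the remaining exponent.
  Δ-^-< : ∀ {m} j → j ℕ.< m → ∀ x → Δ m (λ i → (i · 1#) ^ j) x ≈ 0#
  Δ-^-< {suc m} zero    _         x = Δ-const m 1# x
  Δ-^-< {suc m} (suc j) (s≤s j<m) x = begin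
    Δ (suc m) (λ i → (i · 1#) ^ suc j) x
      ≈⟨ Δ-Leibniz m (λ i → (i · 1#) ^ j) x ⟩
    x · 1# * Δ (suc m) (λ i → (i · 1#) ^ j) x + suc m · 1# * Δ m (λ i → (i · 1#) ^ j) (suc x)
      ≈⟨ +-cong (*-congˡ (Δ-^-< j (ℕ.m<n⇒m<1+n j<m) x)) (*-congˡ (Δ-^-< j j<m (suc x))) ⟩
    x · 1# * 0# + suc m · 1# * 0#
      ≈⟨ trans (+-cong (zeroʳ _) (zeroʳ _)) (+-identityʳ 0#) ⟩
    0# ∎

  -- In `Δ-Leibniz` the first term now has order above its degree and vanishes; the second supplies
  -- the factor `suc m` of the factorial.
  Δ-^ : ∀ m x → Δ m (λ i → (i · 1#) ^ m) x ≈ (m !) · 1#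
  Δ-^ zero    x = sym (+-identityʳ 1#)
  Δ-^ (suc m) x = begin
    Δ (suc m) (λ i → (i · 1#) ^ suc m) x
      ≈⟨ Δ-Leibniz m (λ i → (i · 1#) ^ m) x ⟩
    x · 1# * Δ (suc m) (λ i → (i · 1#) ^ m) x + suc m · 1# * Δ m (λ i → (i · 1#) ^ m) (suc x)
      ≈⟨ +-cong (trans (*-congˡ (Δ-^-< m ℕ.≤-refl x)) (zeroʳ _)) (*-congˡ (Δ-^ m (suc x))) ⟩
    0# + suc m · 1# * ((m !) · 1#)
      ≈⟨ +-identityˡ _ ⟩
    suc m · 1# * ((m !) · 1#)
      ≈⟨ ×1-homo-* (suc m) (m !) ⟨
    (suc m !) · 1# ∎

  -- Δ m g 0 is the combination of g 0, …, g m with these signed binomial coefficients.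
  Δ-coeff : ℕ → ℕ → Carrier
  Δ-coeff zero    zero    = 1#
  Δ-coeff zero    (suc i) = 0#
  Δ-coeff (suc m) zero    = - Δ-coeff m zero
  Δ-coeff (suc m) (suc i) = Δ-coeff m i + - Δ-coeff m (suc i)

  -- By Pascal's rule, row `suc m` plus row `m` is row `m` shifted by one place, which mirrors
  -- `Δ-step`. Coefficients beyond `m` vanish, so m < n makes the sum complete.
  ∑-Δ-coeff : ∀ {n m} → m ℕ.< n → ∀ g →
              ∑ {n} (λ i → Δ-coeff m (toℕ i) * g (toℕ i)) ≈ Δ m g 0
  ∑-Δ-coeff {suc n} {zero}  _ g = trans (+-cong (*-identityˡ _)
    (trans (sum-cong-≋ {n} λ i → zeroˡ _) (sum-replicate-zero n))) (+-identityʳ _)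
  ∑-Δ-coeff {suc n} {suc m} (s≤s m<n) g = ∙-cancelʳ (Δ m g 0) _ _ (begin
    ∑ {suc n} (λ i → Δ-coeff (suc m) (toℕ i) * g (toℕ i)) + Δ m g 0
      ≈⟨ +-congˡ (∑-Δ-coeff (ℕ.m<n⇒m<1+n m<n) g) ⟨
    ∑ {suc n} (λ i → Δ-coeff (suc m) (toℕ i) * g (toℕ i)) + ∑ {suc n} (λ i → Δ-coeff m (toℕ i) * g (toℕ i))
      ≈⟨ ∑-distrib-+ {suc n} (λ i → Δ-coeff (suc m) (toℕ i) * g (toℕ i)) (λ i → Δ-coeff m (toℕ i) * g (toℕ i)) ⟨
    ∑ {suc n} (λ i → Δ-coeff (suc m) (toℕ i) * g (toℕ i) + Δ-coeff m (toℕ i) * g (toℕ i))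
      ≈⟨ +-cong (trans (sym (distribʳ _ _ _)) (trans (*-congʳ (-‿inverseˡ _)) (zeroˡ _)))
                (sum-cong-≋ {n} λ i → trans (sym (distribʳ _ _ _)) (*-congʳ (x-y+y≈x _ _))) ⟩
    0# + ∑ {n} (λ i → Δ-coeff m (toℕ i) * g (suc (toℕ i)))
      ≈⟨ +-identityˡ _ ⟩
    ∑ {n} (λ i → Δ-coeff m (toℕ i) * g (suc (toℕ i)))
      ≈⟨ ∑-Δ-coeff m<n (g ∘ suc) ⟩
    Δ m (g ∘ suc) 0
      ≈⟨ Δ-shift m g 0 ⟩
    Δ m g 1
      ≈⟨ Δ-step m g 0 ⟨
    Δ (suc m) g 0 + Δ m g 0 ∎)

module DualNumbers {c ℓ} (A : CommutativeRing c ℓ) where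

  open CommutativeRing A hiding (zero)
  open import Algebra.Properties.Semiring.Sum semiring renaming (sum to ∑)
  open import Algebra.Properties.CommutativeSemiring.Exp commutativeSemiring
  open import Algebra.Properties.Semiring.Mult semiring renaming (_×_ to _·_)
  open import Relation.Binary.Reasoning.Setoid setoid
  open FiniteDifferences A

  -- The ring A[ε]/(ε²) as the idealization of `A` by itself: the pair (a , b) stands for a + b ε.
  dual : CommutativeRing c ℓ
  dual = record
    { isCommutativeRing = record
      { isRing = Idealization.isRingᴺ ring TensorUnit.bimodule
      ; *-comm = λ { (a , b) (a′ , b′) →
          *-comm a a′ , trans (+-comm _ _) (+-cong (*-comm b a′) (*-comm a b′)) }
      }
    }

  module D = CommutativeRing dual
  open import Algebra.Properties.Semiring.Exp D.semiring using () renaming (_^_ to _^ᴰ_)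
  open import Algebra.Properties.Semiring.Sum D.semiring using () renaming (sum to ∑ᴰ)
  open InjectiveSums dual using (powerSum; IsSubring)

  constᴰ : Carrier → D.Carrier
  constᴰ a = a , 0#

  constᴰ-isHomomorphism : IsRingHomomorphism rawRing D.rawRing constᴰ
  constᴰ-isHomomorphism = record
    { isSemiringHomomorphism = record
      { isNearSemiringHomomorphism = record
        { +-isMonoidHomomorphism = record
          { isMagmaHomomorphism = record
            { isRelHomomorphism = record { cong = λ a≈b → a≈b , refl }
            ; homo = λ _ _ → refl , sym (+-identityʳ 0#)
            }
          ; ε-homo = D.refl
          }
        ; *-homo = λ a b → refl , sym (trans (+-cong (zeroʳ a) (zeroˡ b)) (+-identityʳ 0#))
        }
      ; 1#-homo = D.refl
      }
    ; -‿homo = λ _ → refl , trans (sym (-‿inverseʳ 0#)) (+-identityˡ _)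
    }

  IsConst : D.Carrier → Set ℓ
  IsConst x = proj₂ x ≈ 0#

  isConst-isSubring : IsSubring IsConst
  isConst-isSubring = record
    { P-resp = λ x≈y Px → trans (sym (proj₂ x≈y)) Px
    ; P-0    = refl
    ; P-1    = refl
    ; P-+    = λ Px Py → trans (+-cong Px Py) (+-identityʳ 0#)
    ; P-*    = λ Px Py → trans (+-cong (trans (*-congˡ Py) (zeroʳ _)) (trans (*-congʳ Px) (zeroˡ _))) (+-identityʳ 0#)
    ; P-neg  = λ Px → trans (-‿cong Px) (trans (sym (+-identityˡ _)) (-‿inverseʳ 0#))
    }

  proj₁-^ : ∀ x e → proj₁ (x ^ᴰ e) ≈ proj₁ x ^ e
  proj₁-^ x zero    = refl
  proj₁-^ x (suc e) = *-congˡ (proj₁-^ x e)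

  -- The power rule: multiplication in the dual numbers makes the ε-part obey the product rule of a
  -- derivative.
  proj₂-^ : ∀ x e → proj₂ (x ^ᴰ suc e) ≈ suc e · (proj₂ x * proj₁ x ^ e)
  proj₂-^ x zero    = trans (+-congʳ (zeroʳ _)) (+-comm _ _)
  proj₂-^ x@(a , b) (suc e) = begin
    a * proj₂ (x ^ᴰ suc e) + b * proj₁ (x ^ᴰ suc e)  ≈⟨ +-comm _ _ ⟩
    b * proj₁ (x ^ᴰ suc e) + a * proj₂ (x ^ᴰ suc e)  ≈⟨ +-cong (*-congˡ (proj₁-^ x (suc e))) (*-congˡ (proj₂-^ x e)) ⟩
    b * a ^ suc e + a * (suc e · (b * a ^ e))        ≈⟨ +-congˡ (×-comm-* (suc e) a _) ⟩
    b * a ^ suc e + suc e · (a * (b * a ^ e))        ≈⟨ +-congˡ (×-congʳ (suc e) (x∙yz≈y∙xz a b _)) ⟩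
    suc (suc e) · (b * a ^ suc e)                    ∎
    where open import Algebra.Properties.CommutativeSemigroup *-commutativeSemigroup using (x∙yz≈y∙xz)

  proj₂-∑ : ∀ {n} (f : Fin n → D.Carrier) →
            proj₂ (∑ᴰ f) ≈ ∑ (proj₂ ∘ f)
  proj₂-∑ {zero}  f = refl
  proj₂-∑ {suc n} f = +-congˡ (proj₂-∑ (f ∘ suc))

  ×-∑ : ∀ {n} k (f : Fin n → Carrier) → ∑ (λ i → k · f i) ≈ k · ∑ f
  ×-∑ {n} zero    f = sum-replicate-zero n
  ×-∑     (suc k) f = trans (∑-distrib-+ f _) (+-congˡ (×-∑ k f))

  -- Here `m` is the order of the difference, eventually 2k - 1. Coordinates start at 0, which makes
  -- the weighted sums differences at 0.
  point : ∀ n → ℕ → Fin n → D.Carrier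
  point n m i = toℕ i · 1# , Δ-coeff m (toℕ i)

  proj₂-powerSum : ∀ {n m} → m ℕ.< n → ∀ e →
                   proj₂ (powerSum (point n m) (suc e)) ≈ suc e · Δ m (λ i → (i · 1#) ^ e) 0
  proj₂-powerSum {n} {m} m<n e = begin
    proj₂ (powerSum (point n m) (suc e))
      ≈⟨ proj₂-∑ {n} _ ⟩
    ∑ {n} (λ i → proj₂ (point n m i ^ᴰ suc e))
      ≈⟨ sum-cong-≋ {n} (λ i → proj₂-^ (point n m i) e) ⟩
    ∑ {n} (λ i → suc e · (Δ-coeff m (toℕ i) * (toℕ i · 1#) ^ e))
      ≈⟨ ×-∑ {n} (suc e) _ ⟩
    suc e · ∑ {n} (λ i → Δ-coeff m (toℕ i) * (toℕ i · 1#) ^ e)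
      ≈⟨ ×-congʳ (suc e) (∑-Δ-coeff m<n (λ i → (i · 1#) ^ e)) ⟩
    suc e · Δ m (λ i → (i · 1#) ^ e) 0 ∎

  -- The power rule lowers the exponent by one, so the difference of order m meets x^{e-1} with e -
  -- 1 < m. For e = 0 every summand is 1.
  powerSum-const : ∀ {n m} → m ℕ.< n → ∀ e → e ℕ.≤ m → IsConst (powerSum (point n m) e)
  powerSum-const {n} m<n zero    _   = trans (proj₂-∑ {n} _) (sum-replicate-zero n)
  powerSum-const {n} {m} m<n (suc e) e<m = trans (proj₂-powerSum m<n e)
    (trans (×-congʳ (suc e) (Δ-^-< e e<m 0)) (×-homo-0ʳ (suc e)))
    where
    ×-homo-0ʳ : ∀ k → k · 0# ≈ 0#
    ×-homo-0ʳ zero    = refl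
    ×-homo-0ʳ (suc k) = trans (+-identityˡ _) (×-homo-0ʳ k)

  -- At exponent m + 1 the difference of order m meets x^m, giving (m + 1) m!.
  powerSum-nonConst : ∀ {n m} → m ℕ.< n → proj₂ (powerSum (point n m) (suc m)) ≈ (suc m !) · 1#
  powerSum-nonConst {n} {m} m<n = trans (proj₂-powerSum m<n m)
    (trans (×-congʳ (suc m) (Δ-^ m 0)) (×-assocˡ 1# (suc m) (m !)))

-- Evaluation of polynomials

fieldRing : ∀ {c ℓ₁ ℓ₂} → HeytingField c ℓ₁ ℓ₂ → CommutativeRing c ℓ₁
fieldRing K = HeytingCommutativeRing.commutativeRing (HeytingField.heytingCommutativeRing K)

module FilterTerms {c ℓ₁ ℓ₂ x} (K : HeytingField c ℓ₁ ℓ₂) {X : Set x} (_≟_ : DecidableEquality X) where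

  open Polynomials K _≟_
  open HeytingField K using (0#; _+_)

  module _ {p} {P : Monomial → Set p} (P? : Unary.Decidable P) (resp : ∀ {m m′} → m ↭ m′ → P m → P m′) where

    -- Lists that are permutations of each other denote one monomial; as `P` respects `↭`, all terms
    -- of a monomial are kept or dropped together.
    keep : Poly → Poly
    keep = filter (P? ∘ proj₂)

    coeff-keep : ∀ q {m} → P m → coeff (keep q) m ≡ coeff q m
    coeff-keep []            Pm = ≡.refl
    coeff-keep ((a , m′) ∷ q) {m} Pm with P? m′
    ... | yes Pm′ with m′ ↭? m
    ...   | yes _ = ≡.cong (a +_) (coeff-keep q Pm)
    ...   | no  _ = coeff-keep q Pm
    coeff-keep ((a , m′) ∷ q) {m} Pm | no ¬Pm′ with m′ ↭? m
    ...   | yes m′↭m = contradiction (resp (↭-sym m′↭m) Pm) ¬Pm′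
    ...   | no  _    = coeff-keep q Pm

    coeff-keep-¬ : ∀ q {m} → ¬ P m → coeff (keep q) m ≡ 0#
    coeff-keep-¬ []            ¬Pm = ≡.refl
    coeff-keep-¬ ((a , m′) ∷ q) {m} ¬Pm with P? m′
    ... | no  _   = coeff-keep-¬ q ¬Pm
    ... | yes Pm′ with m′ ↭? m
    ...   | yes m′↭m = contradiction (resp m′↭m Pm′) ¬Pm
    ...   | no  _    = coeff-keep-¬ q ¬Pm

module Evaluation {c ℓ₁ ℓ₂ x c′ ℓ′} (K : HeytingField c ℓ₁ ℓ₂) {X : Set x} (_≟_ : DecidableEquality X)
  (R : CommutativeRing c′ ℓ′) where

  private
    module K = HeytingField K
  open CommutativeRing R hiding (zero)
  open Polynomials K _≟_
  open FilterTerms K _≟_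
  open import Algebra.Properties.CommutativeSemigroup +-commutativeSemigroup using ()
    renaming (x∙yz≈y∙xz to x+yz≈y+xz)
  open import Algebra.Properties.CommutativeSemigroup *-commutativeSemigroup using (interchange)
    renaming (x∙yz≈y∙xz to x*yz≈y*xz)
  open import Relation.Binary.Reasoning.Setoid setoid

  evalMonomial : (X → Carrier) → Monomial → Carrier
  evalMonomial y []      = 1#
  evalMonomial y (x ∷ m) = y x * evalMonomial y m

  evalMonomial-cong : ∀ {y y′} → (∀ x → y x ≈ y′ x) → ∀ m → evalMonomial y m ≈ evalMonomial y′ m
  evalMonomial-cong y≈y′ []      = refl
  evalMonomial-cong y≈y′ (x ∷ m) = *-cong (y≈y′ x) (evalMonomial-cong y≈y′ m)

  evalMonomial-↭ : ∀ y {m m′} → m ↭ m′ → evalMonomial y m ≈ evalMonomial y m′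
  evalMonomial-↭ y ↭.refl         = refl
  evalMonomial-↭ y (↭.prep x p)   = *-congˡ (evalMonomial-↭ y p)
  evalMonomial-↭ y (↭.swap x z p) =
    trans (x*yz≈y*xz _ _ _) (*-congˡ (*-congˡ (evalMonomial-↭ y p)))
  evalMonomial-↭ y (↭.trans p q)  = trans (evalMonomial-↭ y p) (evalMonomial-↭ y q)

  evalMonomial-++ : ∀ y m m′ → evalMonomial y (m ++ m′) ≈ evalMonomial y m * evalMonomial y m′
  evalMonomial-++ y []      m′ = sym (*-identityˡ _)
  evalMonomial-++ y (x ∷ m) m′ = trans (*-congˡ (evalMonomial-++ y m m′)) (sym (*-assoc _ _ _))

  evalMonomial-map : ∀ y (φ : X → X) m → evalMonomial y (map φ m) ≡ evalMonomial (y ∘ φ) m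
  evalMonomial-map y φ []      = ≡.refl
  evalMonomial-map y φ (x ∷ m) = ≡.cong (y (φ x) *_) (evalMonomial-map y φ m)

  module _ {ι : K.Carrier → Carrier}
    (ι-isHomomorphism : IsRingHomomorphism (CommutativeRing.rawRing (fieldRing K)) rawRing ι) where

    open IsRingHomomorphism ι-isHomomorphism
      renaming (⟦⟧-cong to ι-cong; +-homo to ι-+; *-homo to ι-*; 0#-homo to ι-0)

    eval : (X → Carrier) → Poly → Carrier
    eval y []            = 0#
    eval y ((a , m) ∷ p) = ι a * evalMonomial y m + eval y p

    eval-point-cong : ∀ {y y′} → (∀ x → y x ≈ y′ x) → ∀ p → eval y p ≈ eval y′ p
    eval-point-cong y≈y′ []            = refl
    eval-point-cong y≈y′ ((a , m) ∷ p) =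
      +-cong (*-congˡ (evalMonomial-cong y≈y′ m)) (eval-point-cong y≈y′ p)

    eval-rename : ∀ y φ p → eval y (rename φ p) ≡ eval (y ∘ φ) p
    eval-rename y φ []            = ≡.refl
    eval-rename y φ ((a , m) ∷ p) =
      ≡.cong₂ _+_ (≡.cong (ι a *_) (evalMonomial-map y φ m)) (eval-rename y φ p)

    eval-⊕ : ∀ y p q → eval y (p ⊕ q) ≈ eval y p + eval y q
    eval-⊕ y []      q = sym (+-identityˡ _)
    eval-⊕ y (t ∷ p) q = trans (+-congˡ (eval-⊕ y p q)) (sym (+-assoc _ _ _))

    eval-⊗-term : ∀ y a m q → eval y (map (λ { (b , m′) → a K.* b , m ++ m′ }) q) ≈ ι a * evalMonomial y m * eval y q
    eval-⊗-term y a m []             = sym (zeroʳ _)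
    eval-⊗-term y a m ((b , m′) ∷ q) = begin
      ι (a K.* b) * evalMonomial y (m ++ m′) + eval y (map _ q)
        ≈⟨ +-cong (*-cong (ι-* a b) (evalMonomial-++ y m m′)) (eval-⊗-term y a m q) ⟩
      ι a * ι b * (evalMonomial y m * evalMonomial y m′) + ι a * evalMonomial y m * eval y q
        ≈⟨ +-congʳ (interchange _ _ _ _) ⟩
      ι a * evalMonomial y m * (ι b * evalMonomial y m′) + ι a * evalMonomial y m * eval y q
        ≈⟨ distribˡ _ _ _ ⟨
      ι a * evalMonomial y m * (ι b * evalMonomial y m′ + eval y q) ∎

    eval-⊗ : ∀ y p q → eval y (p ⊗ q) ≈ eval y p * eval y q
    eval-⊗ y []            q = sym (zeroˡ _)
    eval-⊗ y ((a , m) ∷ p) q = begin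
      eval y (((a , m) ∷ p) ⊗ q)
        ≈⟨ eval-⊕ y (map _ q) (p ⊗ q) ⟩
      eval y (map _ q) + eval y (p ⊗ q)
        -- The pattern lambda in `_⊗_` and the one in `eval-⊗-term` agree only pointwise, hence
        -- `map-cong`.
        ≈⟨ +-cong (trans (reflexive (≡.cong (eval y) (List.map-cong (λ _ → ≡.refl) q))) (eval-⊗-term y a m q)) (eval-⊗ y p q) ⟩
      ι a * evalMonomial y m * eval y q + eval y p * eval y q
        ≈⟨ distribʳ _ _ _ ⟨
      (ι a * evalMonomial y m + eval y p) * eval y q ∎

    ≁-resp : ∀ (m : Monomial) {m₁ m₂} → m₁ ↭ m₂ → ¬ (m₁ ↭ m) → ¬ (m₂ ↭ m)
    ≁-resp m m₁↭m₂ ¬m₁↭m m₂↭m = ¬m₁↭m (↭-trans m₁↭m₂ m₂↭m)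

    without : Monomial → Poly → Poly
    without m = keep (λ m′ → ¬? (m′ ↭? m)) (≁-resp m)

    -- Like terms are collected: since `ι` is additive, all occurrences of `m` together contribute
    -- its total coefficient.
    eval-without : ∀ y m p → eval y p ≈ ι (coeff p m) * evalMonomial y m + eval y (without m p)
    eval-without y m [] = sym (trans (+-identityʳ _) (trans (*-congʳ ι-0) (zeroˡ _)))
    eval-without y m ((a , m′) ∷ p) with m′ ↭? m
    ... | yes m′↭m = begin
      ι a * evalMonomial y m′ + eval y p
        ≈⟨ +-cong (*-congˡ (evalMonomial-↭ y m′↭m)) (eval-without y m p) ⟩
      ι a * evalMonomial y m + (ι (coeff p m) * evalMonomial y m + eval y (without m p))
        ≈⟨ +-assoc _ _ _ ⟨
      ι a * evalMonomial y m + ι (coeff p m) * evalMonomial y m + eval y (without m p)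
        ≈⟨ +-congʳ (trans (*-congʳ (ι-+ a _)) (distribʳ _ _ _)) ⟨
      ι (a K.+ coeff p m) * evalMonomial y m + eval y (without m p) ∎
    ... | no _ = begin
      ι a * evalMonomial y m′ + eval y p
        ≈⟨ +-congˡ (eval-without y m p) ⟩
      ι a * evalMonomial y m′ + (ι (coeff p m) * evalMonomial y m + eval y (without m p))
        ≈⟨ x+yz≈y+xz _ _ _ ⟩
      ι (coeff p m) * evalMonomial y m + (ι a * evalMonomial y m′ + eval y (without m p)) ∎

    -- At least the head term is removed; this makes the recursion in `eval-cong` terminate.
    length-without : ∀ a m p → length (without m ((a , m) ∷ p)) ℕ.≤ length p
    length-without a m p with m ↭? m
    ... | yes _    = List.length-filter _ p
    ... | no ¬m↭m = contradiction ↭-refl ¬m↭m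

    coeff-without : ∀ m p {m′} → ¬ (m′ ↭ m) → coeff (without m p) m′ ≡ coeff p m′
    coeff-without m = coeff-keep (λ m′ → ¬? (m′ ↭? m)) (≁-resp m)

    coeff-without-↭ : ∀ m p {m′} → m′ ↭ m → coeff (without m p) m′ ≡ K.0#
    coeff-without-↭ m p m′↭m = coeff-keep-¬ (λ m′ → ¬? (m′ ↭? m)) (≁-resp m) p (λ ¬m′↭m → ¬m′↭m m′↭m)

    without-cong : ∀ m p q → p ≋ q → without m p ≋ without m q
    without-cong m p q p≋q m′ with m′ ↭? m
    ... | yes m′↭m  = K.reflexive (≡.trans (coeff-without-↭ m p m′↭m) (≡.sym (coeff-without-↭ m q m′↭m)))
    ... | no  ¬m′↭m = K.trans (K.reflexive (coeff-without m p ¬m′↭m))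
                        (K.trans (p≋q m′) (K.sym (K.reflexive (coeff-without m q ¬m′↭m))))

    -- Evaluation is defined on term lists, so its dependence on coefficients alone needs proof. The
    -- first monomial of either list is split off from both sides, where its coefficients agree, and
    -- the shorter remainders are compared.
    eval-cong : ∀ y p q → p ≋ q → eval y p ≈ eval y q
    eval-cong y p q = go (length p ℕ.+ length q) p q ℕ.≤-refl
      where
      go : ∀ l p q → length p ℕ.+ length q ℕ.≤ l → p ≋ q → eval y p ≈ eval y q
      drop : ∀ l m p q → length (without m p) ℕ.+ length (without m q) ℕ.≤ l → p ≋ q → eval y p ≈ eval y q
      go zero    []            []            _  _   = refl
      go (suc l) []            []            _  _   = refl
      go (suc l) p@((a , m) ∷ p′) q (s≤s len) p≋q = drop l m p q
        (ℕ.≤-trans (ℕ.+-mono-≤ (length-without a m p′) (List.length-filter _ q)) len) p≋q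
      go (suc l) []            q@((a , m) ∷ q′) (s≤s len) p≋q = drop l m [] q
        (ℕ.≤-trans (length-without a m q′) len) p≋q
      drop l m p q len p≋q = begin
        eval y p
          ≈⟨ eval-without y m p ⟩
        ι (coeff p m) * evalMonomial y m + eval y (without m p)
          ≈⟨ +-cong (*-congʳ (ι-cong (p≋q m))) (go l (without m p) (without m q) len (without-cong m p q p≋q)) ⟩
        ι (coeff q m) * evalMonomial y m + eval y (without m q)
          ≈⟨ eval-without y m q ⟨
        eval y q ∎

-- Graph invariants

-- Pigeonhole: if `j` were missed, punching it out would inject a set of n + 1 elements into one of
-- n.
injective⇒surjective : ∀ {n} {f : Fin n → Fin n} → Injective _≡_ _≡_ f → ∀ j → ∃ λ i → f i ≡ j
injective⇒surjective {suc n} {f} f-inj j with Fin.any? (λ i → f i Fin.≟ j)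
... | yes i,fi≡j = i,fi≡j
... | no  j∉f    = contradiction
  (Fin.injective⇒≤ {f = λ i → punchOut (misses i)}
    (λ {i} {i′} eq → f-inj (Fin.punchOut-injective (misses i) (misses i′) eq)))
  ℕ.1+n≰n
  where
  misses : ∀ i → j ≢ f i
  misses i j≡fi = j∉f (i , ≡.sym j≡fi)

injective⇒permutation : ∀ {n} {f : Fin n → Fin n} → Injective _≡_ _≡_ f →
                        ∃ λ (σ : Permutation′ n) → ∀ i → σ ⟨$⟩ʳ i ≡ f i
injective⇒permutation {f = f} f-inj =
  permutation f (proj₁ ∘ onto) (proj₂ ∘ onto) (λ i → f-inj (proj₂ (onto (f i)))) , λ _ → ≡.refl
  where onto = injective⇒surjective f-inj

pair-irrelevant : ∀ {n} {i j : Fin n} (p q : i ≢ j) → pair i j p ≡ pair i j q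
pair-irrelevant {i = i} {j} p q with Fin.<-cmp i j
... | tri< _ _ _   = ≡.refl
... | tri≈ _ i≡j _ = contradiction i≡j p
... | tri> _ _ _   = ≡.refl

pair-sym : ∀ {n} {i j : Fin n} (p : i ≢ j) (q : j ≢ i) → pair i j p ≡ pair j i q
pair-sym {i = i} {j} p q with Fin.<-cmp i j | Fin.<-cmp j i
... | tri< i<j _ _ | tri< j<i _ _ = contradiction j<i (Fin.<-asym i<j)
... | tri< i<j _ _ | tri> _ _ i<j′ = ≡.cong ⟪ i , j ,_⟫ (Fin.<-irrelevant i<j i<j′)
... | tri> _ _ j<i | tri< j<i′ _ _ = ≡.cong ⟪ j , i ,_⟫ (Fin.<-irrelevant j<i j<i′)
... | tri> _ _ j<i | tri> _ _ i<j = contradiction j<i (Fin.<-asym i<j)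
... | tri≈ _ i≡j _ | _ = contradiction i≡j p
... | tri< _ _ _ | tri≈ _ j≡i _ = contradiction j≡i q
... | tri> _ _ _ | tri≈ _ j≡i _ = contradiction j≡i q

permute-pair : ∀ {n} (σ : Permutation′ n) {i j} (p : i ≢ j) (q : σ ⟨$⟩ʳ i ≢ σ ⟨$⟩ʳ j) →
               permute σ (pair i j p) ≡ pair (σ ⟨$⟩ʳ i) (σ ⟨$⟩ʳ j) q
permute-pair σ {i} {j} p q with Fin.<-cmp i j
... | tri< _ _ _   = pair-irrelevant _ q
... | tri≈ _ i≡j _ = contradiction i≡j p
... | tri> _ _ _   = pair-sym _ q

-- Substituting products of vertex values for the edge variables

module EdgeProduct {c ℓ₁ ℓ₂ c′ ℓ′} (K : HeytingField c ℓ₁ ℓ₂) (R : CommutativeRing c′ ℓ′)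
  {ι : HeytingField.Carrier K → CommutativeRing.Carrier R}
  (ι-isHomomorphism : IsRingHomomorphism
    (CommutativeRing.rawRing (fieldRing K))
    (CommutativeRing.rawRing R) ι)
  (n : ℕ) where

  private
    module K = HeytingField K
  import Algebra.Properties.Semiring.Sum (CommutativeRing.semiring (fieldRing K)) as Σᴷ
  open CommutativeRing R hiding (zero)
  open GraphInvariants K n
  open FilterTerms K (_≟ᴾ_ {n})
  open Evaluation K (_≟ᴾ_ {n}) R
  open InjectiveSums R
  open import Algebra.Properties.Semiring.Sum semiring renaming (sum to ∑)
  open import Algebra.Properties.CommutativeSemiring.Exp commutativeSemiring
  open import Algebra.Properties.Semiring.Mult semiring using () renaming (_×_ to _·_)
  open import Relation.Binary.Reasoning.Setoid setoid
  open Pair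

  edge : (Fin n → Carrier) → Pair n → Carrier
  edge z q = z (lo q) * z (hi q)

  edge-pair : ∀ z {i j} (p : i ≢ j) → edge z (pair i j p) ≈ z i * z j
  edge-pair z {i} {j} p with Fin.<-cmp i j
  ... | tri< _ _ _   = refl
  ... | tri≈ _ i≡j _ = contradiction i≡j p
  ... | tri> _ _ _   = *-comm _ _

  evalEdges : (Fin n → Carrier) → Poly → Carrier
  evalEdges z = eval ι-isHomomorphism (edge z)

  -- The substitution is equivariant: permuting the variables amounts to permuting the coordinates
  -- of the point.
  evalEdges-∙ : ∀ z σ p → evalEdges z (σ ∙ p) ≈ evalEdges (λ i → z (σ ⟨$⟩ʳ i)) p
  evalEdges-∙ z σ p = trans (reflexive (eval-rename ι-isHomomorphism (edge z) (permute σ) p))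
    (eval-point-cong ι-isHomomorphism (λ q → edge-pair z _) p)

  -- The degree sequence of the multigraph whose edges are the factors of the monomial.
  exponents : Monomial → Vec ℕ n
  exponents []      = Vec.replicate n 0
  exponents (q ∷ m) = Vec.updateAt (Vec.updateAt (exponents m) (hi q) suc) (lo q) suc

  evalMonomial-edge : ∀ z m → evalMonomial (edge z) m ≈ power z (exponents m)
  evalMonomial-edge z []      = sym (power-zeros z)
  evalMonomial-edge z (q ∷ m) = begin
    z (lo q) * z (hi q) * evalMonomial (edge z) m
      ≈⟨ *-assoc _ _ _ ⟩
    z (lo q) * (z (hi q) * evalMonomial (edge z) m)
      ≈⟨ *-congˡ (*-congˡ (evalMonomial-edge z m)) ⟩
    z (lo q) * (z (hi q) * power z (exponents m))
      ≈⟨ *-congˡ (power-suc z (exponents m) (hi q)) ⟨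
    z (lo q) * power z (Vec.updateAt (exponents m) (hi q) suc)
      ≈⟨ power-suc z (Vec.updateAt (exponents m) (hi q) suc) (lo q) ⟨
    power z (exponents (q ∷ m)) ∎

  -- The handshake lemma: each edge has two ends. This is the source of the factor 2 between the
  -- degree of an invariant and the exponents of the power sums.
  sum-exponents : ∀ m → sum (toList (exponents m)) ≡ length m ℕ.* 2
  sum-exponents []      = sum-zeros n
    where
    sum-zeros : ∀ l → sum (toList (Vec.replicate l 0)) ≡ 0
    sum-zeros zero    = ≡.refl
    sum-zeros (suc l) = sum-zeros l
  sum-exponents (q ∷ m) = ≡.trans (sum-suc (Vec.updateAt (exponents m) (hi q) suc) (lo q))
    (≡.cong suc (≡.trans (sum-suc (exponents m) (hi q)) (≡.cong suc (sum-exponents m))))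
    where
    sum-suc : ∀ {l} (es : Vec ℕ l) j → sum (toList (Vec.updateAt es j suc)) ≡ suc (sum (toList es))
    sum-suc (e ∷ es) zero    = ≡.refl
    sum-suc (e ∷ es) (suc j) = ≡.trans (≡.cong (e ℕ.+_) (sum-suc es j)) (ℕ.+-suc e _)

  weighted : ∀ z p → Vec (Fin n) n → Carrier
  weighted z p v = weight everything v * evalEdges (z ∘ lookup v) p

  -- The injSum is n!, the number of permutations.
  average : ∀ z p → Invariant p →
            injSum z everything (replicate n 0) * evalEdges z p ≈ vecSum (weighted z p)
  average z p p-inv = begin
    injSum z everything (replicate n 0) * evalEdges z p
      ≈⟨ *-congʳ (reflexive (≡.cong (injSum z everything) (toList-replicate n))) ⟨
    injSum z everything (toList (Vec.replicate n 0)) * evalEdges z p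
      ≈⟨ *-comm _ _ ⟩
    evalEdges z p * injSum z everything (toList (Vec.replicate n 0))
      ≈⟨ *-congˡ (injSum≈vecSum z everything (Vec.replicate n 0)) ⟩
    evalEdges z p * vecSum (λ v → weight everything v * power (z ∘ lookup v) (Vec.replicate n 0))
      ≈⟨ *-distribˡ-vecSum _ (λ v → weight everything v * power (z ∘ lookup v) (Vec.replicate n 0)) ⟩
    vecSum (λ v → evalEdges z p * (weight everything v * power (z ∘ lookup v) (Vec.replicate n 0)))
      ≈⟨ vecSum-cong {l = n} (λ v → trans (*-comm _ _)
           (trans (*-congʳ (trans (*-congˡ (power-zeros (z ∘ lookup v))) (*-identityʳ _))) (permuted v))) ⟩
    vecSum (weighted z p) ∎
    where
    toList-replicate : ∀ l → toList (Vec.replicate l 0) ≡ replicate l 0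
    toList-replicate zero    = ≡.refl
    toList-replicate (suc l) = ≡.cong (0 ∷_) (toList-replicate l)

    -- A non-injective vector gives 0 on both sides; an injective one is a permutation, which
    -- invariance transfers from the polynomial to the point.
    permuted : ∀ v → weight everything v * evalEdges z p ≈ weighted z p v
    permuted v with weight-injective everything v
    ... | inj₁ w≈0   = trans (*-congʳ w≈0) (trans (zeroˡ _) (sym (trans (*-congʳ w≈0) (zeroˡ _))))
    ... | inj₂ v-inj with σ , σ≗v ← injective⇒permutation v-inj = *-congˡ (begin
      evalEdges z p
        ≈⟨ eval-cong ι-isHomomorphism (edge z) (σ ∙ p) p (p-inv σ) ⟨
      evalEdges z (σ ∙ p)
        ≈⟨ evalEdges-∙ z σ p ⟩
      evalEdges (λ i → z (σ ⟨$⟩ʳ i)) p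
        ≈⟨ eval-point-cong ι-isHomomorphism (λ q →
             *-cong (reflexive (≡.cong z (σ≗v (lo q)))) (reflexive (≡.cong z (σ≗v (hi q))))) p ⟩
      evalEdges (z ∘ lookup v) p ∎)

  -- A degree bound on coefficients still allows high terms that cancel in the list; dropping them
  -- bounds every listed term.
  truncate : ∀ {d p} → DegreeAtMost d p →
             ∃ λ q → p ≋ q × All (λ t → length (proj₂ t) ≤ d) q
  truncate {d} {p} p-deg = keep small? small-resp p , p≋ , all-filter (small? ∘ proj₂) p
    where
    Small : Monomial → Set
    Small m = length m ≤ d

    small? = λ m → length m ℕ.≤? d

    small-resp : ∀ {m m′} → m ↭ m′ → Small m → Small m′
    small-resp m↭m′ = ≡.subst (_≤ d) (↭-length m↭m′)

    p≋ : p ≋ keep small? small-resp p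
    p≋ m with small? m
    ... | yes small = K.sym (K.reflexive (coeff-keep small? small-resp p small))
    ... | no  large = K.trans (p-deg m (ℕ.≰⇒> large)) (K.sym (K.reflexive (coeff-keep-¬ small? small-resp p large)))

  ⨁ : ∀ {l} → (Fin l → Poly) → Poly
  ⨁ = Vector.foldr _⊕_ []

  rename-⨁ : ∀ {l} φ (f : Fin l → Poly) → rename φ (⨁ f) ≡ ⨁ (rename φ ∘ f)
  rename-⨁ {zero}  φ f = ≡.refl
  rename-⨁ {suc l} φ f = ≡.trans (List.map-++ (map₂ (map φ)) (f zero) _)
    (≡.cong (rename φ (f zero) ++_) (rename-⨁ φ (f ∘ suc)))

  coeff-⊕ : ∀ p q m → coeff (p ⊕ q) m K.≈ coeff p m K.+ coeff q m
  coeff-⊕ []             q m = K.sym (K.+-identityˡ _)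
  coeff-⊕ ((a , m′) ∷ p) q m with m′ ↭? m
  ... | yes _ = K.trans (K.+-cong K.refl (coeff-⊕ p q m)) (K.sym (K.+-assoc _ _ _))
  ... | no  _ = coeff-⊕ p q m

  coeff-⨁ : ∀ {l} (f : Fin l → Poly) m → coeff (⨁ f) m K.≈ Σᴷ.sum (λ i → coeff (f i) m)
  coeff-⨁ {zero}  f m = K.refl
  coeff-⨁ {suc l} f m = K.trans (coeff-⊕ (f zero) _ m) (K.+-cong K.refl (coeff-⨁ (f ∘ suc) m))

  evalEdges-⨁ : ∀ {l} z (f : Fin l → Poly) → evalEdges z (⨁ f) ≈ ∑ (λ i → evalEdges z (f i))
  evalEdges-⨁ {zero}  z f = refl
  evalEdges-⨁ {suc l} z f = trans (eval-⊕ ι-isHomomorphism (edge z) (f zero) _) (+-congˡ (evalEdges-⨁ z (f ∘ suc)))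

  -- The zero polynomial on the diagonal lets both indices range over all of `Fin n` and be
  -- reindexed independently.
  edgePower : ℕ → Fin n → Fin n → Poly
  edgePower k i j with i Fin.≟ j
  ... | yes _  = []
  ... | no i≢j = (K.1# , replicate k (pair i j i≢j)) ∷ []

  rename-edgePower : ∀ σ k i j → rename (permute σ) (edgePower k i j) ≡ edgePower k (σ ⟨$⟩ʳ i) (σ ⟨$⟩ʳ j)
  rename-edgePower σ k i j with i Fin.≟ j | (σ ⟨$⟩ʳ i) Fin.≟ (σ ⟨$⟩ʳ j)
  ... | yes _   | yes _   = ≡.refl
  ... | yes i≡j | no  σ≢  = contradiction (≡.cong (σ ⟨$⟩ʳ_) i≡j) σ≢
  ... | no i≢j  | yes σ≡  = contradiction (Injection.injective (↔⇒↣ σ) σ≡) i≢j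
  ... | no i≢j  | no  σ≢  = ≡.cong (λ m → (K.1# , m) ∷ [])
    (≡.trans (List.map-replicate (permute σ) k _) (≡.cong (replicate k) (permute-pair σ i≢j σ≢)))

  -- Each edge {i,j} contributes x_{ij}^k twice, from (i,j) and (j,i).
  edgePowerSum : ℕ → Poly
  edgePowerSum k = ⨁ {n} λ i → ⨁ {n} λ j → edgePower k i j

  -- Concatenation commutes only up to `≋`, so reindexing along `σ` is done on coefficients, first
  -- in the inner sum and then in the outer one.
  edgePowerSum-invariant : ∀ k → Invariant (edgePowerSum k)
  edgePowerSum-invariant k σ m =
    K.trans (K.reflexive (≡.cong (λ p → coeff p m) (rename-⨁ {n} (permute σ) λ i → ⨁ {n} λ j → edgePower k i j)))
    (K.trans (coeff-⨁ {n} _ m)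
    (K.trans (Σᴷ.sum-cong-≋ {n} λ i →
      K.trans (K.reflexive (≡.cong (λ p → coeff p m) (rename-⨁ {n} (permute σ) λ j → edgePower k i j)))
      (K.trans (coeff-⨁ {n} _ m)
      (K.trans (Σᴷ.sum-cong-≋ {n} λ j → K.reflexive (≡.cong (λ p → coeff p m) (rename-edgePower σ k i j)))
      (K.trans (K.sym (Σᴷ.sum-permute (λ j → coeff (edgePower k (σ ⟨$⟩ʳ i) j) m) σ))
      (K.sym (coeff-⨁ {n} (edgePower k (σ ⟨$⟩ʳ i)) m))))))
    (K.trans (K.sym (Σᴷ.sum-permute (λ i → coeff (⨁ {n} (edgePower k i)) m) σ))
    (K.sym (coeff-⨁ {n} _ m)))))

  evalMonomial-replicate : ∀ y k q → evalMonomial y (replicate k q) ≈ y q ^ k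
  evalMonomial-replicate y zero    q = refl
  evalMonomial-replicate y (suc k) q = *-congˡ (evalMonomial-replicate y k q)

  evalEdges-edgePower-≡ : ∀ z k i → evalEdges z (edgePower k i i) ≈ 0#
  evalEdges-edgePower-≡ z k i with i Fin.≟ i
  ... | yes _  = refl
  ... | no i≢i = contradiction ≡.refl i≢i

  evalEdges-edgePower-≢ : ∀ z k i j → j ≢ i → evalEdges z (edgePower k i j) ≈ z i ^ k * z j ^ k
  evalEdges-edgePower-≢ z k i j j≢i with i Fin.≟ j
  ... | yes i≡j = contradiction (≡.sym i≡j) j≢i
  ... | no i≢j  = begin
    ι K.1# * evalMonomial (edge z) (replicate k (pair i j i≢j)) + 0#
      ≈⟨ +-identityʳ _ ⟩
    ι K.1# * evalMonomial (edge z) (replicate k (pair i j i≢j))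
      ≈⟨ trans (*-congʳ (IsRingHomomorphism.1#-homo ι-isHomomorphism)) (*-identityˡ _) ⟩
    evalMonomial (edge z) (replicate k (pair i j i≢j))
      ≈⟨ evalMonomial-replicate (edge z) k _ ⟩
    edge z (pair i j i≢j) ^ k
      ≈⟨ ^-congˡ k (edge-pair z i≢j) ⟩
    (z i * z j) ^ k
      ≈⟨ ^-distrib-* (z i) (z j) k ⟩
    z i ^ k * z j ^ k ∎

  -- Expanding the square gives the sum over all pairs (i, j); its diagonal part is the power sum of
  -- exponent 2k.
  evalEdges-edgePowerSum : ∀ z k → evalEdges z (edgePowerSum k) + powerSum z (k ℕ.+ k) ≈ powerSum z k * powerSum z k
  evalEdges-edgePowerSum z k = begin
    evalEdges z (edgePowerSum k) + powerSum z (k ℕ.+ k)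
      ≈⟨ +-cong (evalEdges-⨁ {n} z λ i → ⨁ {n} λ j → edgePower k i j) (sum-cong-≋ {n} λ i → ^-homo-* (z i) k k) ⟩
    ∑ {n} (λ i → evalEdges z (⨁ {n} (edgePower k i))) + ∑ {n} (λ i → z i ^ k * z i ^ k)
      ≈⟨ ∑-distrib-+ {n} (λ i → evalEdges z (⨁ {n} (edgePower k i))) (λ i → z i ^ k * z i ^ k) ⟨
    ∑ {n} (λ i → evalEdges z (⨁ {n} (edgePower k i)) + z i ^ k * z i ^ k)
      ≈⟨ sum-cong-≋ {n} row ⟩
    ∑ {n} (λ i → z i ^ k * powerSum z k)
      ≈⟨ *-distribʳ-sum {n} _ _ ⟨
    powerSum z k * powerSum z k ∎
    where
    row : ∀ i → evalEdges z (⨁ {n} (edgePower k i)) + z i ^ k * z i ^ k ≈ z i ^ k * powerSum z k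
    row i = begin
      evalEdges z (⨁ {n} (edgePower k i)) + z i ^ k * z i ^ k
        ≈⟨ +-congʳ (evalEdges-⨁ {n} z (edgePower k i)) ⟩
      ∑ {n} (λ j → evalEdges z (edgePower k i j)) + z i ^ k * z i ^ k
        ≈⟨ ∑-differ-at i (λ j → evalEdges z (edgePower k i j)) (λ j → z i ^ k * z j ^ k) (evalEdges-edgePower-≢ z k i) ⟩
      ∑ {n} (λ j → z i ^ k * z j ^ k) + evalEdges z (edgePower k i i)
        ≈⟨ trans (+-congˡ (evalEdges-edgePower-≡ z k i)) (+-identityʳ _) ⟩
      ∑ {n} (λ j → z i ^ k * z j ^ k)
        ≈⟨ *-distribˡ-sum {n} _ _ ⟨
      z i ^ k * powerSum z k ∎

  -- `P-cancel` undoes the multiplication by n! that averaging introduces.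
  module _ {p} {P : Carrier → Set p} (P-isSubring : IsSubring P) (P-ι : ∀ a → P (ι a))
           (P-cancel : ∀ m x → P (suc m · 1# * x) → P x)
           (z : Fin n → Carrier) (d : ℕ) (P-powerSum : ∀ e → e ≤ d ℕ.* 2 → P (powerSum z e)) where

    open IsSubring P-isSubring

    -- Term by term, a monomial of degree at most d turns into a scalar times an `injSum` of total
    -- exponent at most 2d, to which `P-injSum` applies.
    P-weighted : ∀ q → All (λ t → length (proj₂ t) ≤ d) q → P (vecSum (weighted z q))
    P-weighted [] [] = P-resp (sym (vecSum-zero {l = n} _ λ v → zeroʳ _)) P-0
    P-weighted ((a , m) ∷ q) (deg ∷ degs) = P-resp (sym (begin
      vecSum (weighted z ((a , m) ∷ q))
        ≈⟨ vecSum-cong {l = n} (λ v → distribˡ _ _ _) ⟩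
      vecSum (λ v → weight everything v * (ι a * evalMonomial (edge (z ∘ lookup v)) m) + weighted z q v)
        ≈⟨ vecSum-+ {l = n} _ _ ⟩
      vecSum (λ v → weight everything v * (ι a * evalMonomial (edge (z ∘ lookup v)) m)) + vecSum (weighted z q)
        ≈⟨ +-congʳ (vecSum-cong {l = n} λ v → trans (x∙yz≈y∙xz _ _ _) (*-congˡ (*-congˡ (evalMonomial-edge _ m)))) ⟩
      vecSum (λ v → ι a * (weight everything v * power (z ∘ lookup v) (exponents m))) + vecSum (weighted z q)
        ≈⟨ +-congʳ (*-distribˡ-vecSum {l = n} _ _) ⟨
      ι a * vecSum (λ v → weight everything v * power (z ∘ lookup v) (exponents m)) + vecSum (weighted z q)
        ≈⟨ +-congʳ (*-congˡ (injSum≈vecSum z everything (exponents m))) ⟨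
      ι a * injSum z everything (toList (exponents m)) + vecSum (weighted z q) ∎))
      (P-+ (P-* (P-ι a) (P-injSum z (d ℕ.* 2) P-powerSum (toList (exponents m))
                  (≡.subst (_≤ d ℕ.* 2) (≡.sym (sum-exponents m)) (ℕ.*-monoˡ-≤ 2 deg))))
           (P-weighted q degs))
      where open import Algebra.Properties.CommutativeSemigroup *-commutativeSemigroup using (x∙yz≈y∙xz)

    P-evalEdges-invariant : ∀ q → Invariant q → DegreeAtMost d q → P (evalEdges z q)
    P-evalEdges-invariant q q-inv q-deg
      with q′ , q≋q′ , degs ← truncate {d} {q} q-deg | m , N≈m ← injSum-zeros z n 0 (ℕ.+-identityʳ n)
      -- Invariance is given for `q`, so `q` is averaged; `eval-cong` then replaces it by the
      -- truncated `q′` inside the sum.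
      = P-cancel m _ (P-resp (begin
        vecSum (weighted z q′)
          ≈⟨ vecSum-cong {l = n} (λ v → *-congˡ (eval-cong ι-isHomomorphism (edge (z ∘ lookup v)) q q′ q≋q′)) ⟨
        vecSum (weighted z q)
          ≈⟨ average z q q-inv ⟨
        injSum z everything (replicate n 0) * evalEdges z q
          ≈⟨ *-congʳ N≈m ⟩
        suc m · 1# * evalEdges z q ∎) (P-weighted q′ degs))

    P-evalEdges-adjoin : ∀ {q} → Adjoin (λ q → Invariant q × DegreeAtMost d q) q → P (evalEdges z q)
    P-evalEdges-adjoin (generator {q} (q-inv , q-deg)) = P-evalEdges-invariant q q-inv q-deg
    P-evalEdges-adjoin (scalar a)    = P-+ (P-* (P-ι a) P-1) P-0
    P-evalEdges-adjoin (plus {q} {r} q∈ r∈) = P-resp (sym (eval-⊕ ι-isHomomorphism (edge z) q r))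
      (P-+ (P-evalEdges-adjoin q∈) (P-evalEdges-adjoin r∈))
    P-evalEdges-adjoin (times {q} {r} q∈ r∈) = P-resp (sym (eval-⊗ ι-isHomomorphism (edge z) q r))
      (P-* (P-evalEdges-adjoin q∈) (P-evalEdges-adjoin r∈))
    P-evalEdges-adjoin (resp {q} {r} q≋r q∈) =
      P-resp (eval-cong ι-isHomomorphism (edge z) q r q≋r) (P-evalEdges-adjoin q∈)

    -- Generation puts the value of `edgePowerSum k` into `P`, and the power sum of exponent 2k is
    -- the square of that of exponent k minus this value.
    P-powerSum-doubled : GeneratedInDegreeAtMost d → ∀ k → P (powerSum z k) → P (powerSum z (k ℕ.+ k))
    P-powerSum-doubled generated k Pk = P-cancelʳ
      (P-evalEdges-adjoin (generated (edgePowerSum k) (edgePowerSum-invariant k)))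
      (P-resp (trans (sym (evalEdges-edgePowerSum z k)) (+-comm _ _)) (P-* Pk Pk))

-- The lower bound in characteristic zero

module _ {c ℓ₁ ℓ₂} (K : HeytingField c ℓ₁ ℓ₂) (char0 : CharacteristicZero K) where

  open HeytingField K hiding (zero)
  open import Algebra.Properties.Semiring.Mult (CommutativeRing.semiring (fieldRing K))
    using (×-assoc-*; ×-congʳ) renaming (_×_ to _·_)
  open import Relation.Binary.Reasoning.Setoid (CommutativeRing.setoid (fieldRing K))
  open DualNumbers (fieldRing K)
  open import Algebra.Properties.Semiring.Mult D.semiring
    using () renaming (_×_ to _·ᴰ_; ×-assoc-* to ·ᴰ-assoc-*; ×-congʳ to ·ᴰ-congʳ)

  -- Equality need not be decidable, so tightness is used: if x were apart from 0 it would be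
  -- invertible, and multiplying by its inverse would make a positive integer vanish.
  suc·-cancel : ∀ m x → suc m · x ≈ 0# → x ≈ 0#
  suc·-cancel m x mx≈0 = proj₁ (tight x 0#) λ x#0 →
    let y , y*x≈1 , _ = #⇒invertible x#0 in
    char0 m (begin
      suc m · 1#              ≈⟨ ×-congʳ (suc m) (trans (*-comm _ _) y*x≈1) ⟨
      suc m · ((x - 0#) * y)  ≈⟨ ×-assoc-* (suc m) (x - 0#) y ⟨
      suc m · (x - 0#) * y    ≈⟨ *-congʳ (×-congʳ (suc m) (trans (+-congˡ -0#≈0#) (+-identityʳ x))) ⟩
      suc m · x * y           ≈⟨ *-congʳ mx≈0 ⟩
      0# * y                  ≈⟨ zeroˡ y ⟩
      0#                      ∎)
    where open import Algebra.Properties.Ring (CommutativeRing.ring (fieldRing K)) using (-0#≈0#)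

  isConst-cancel : ∀ m x → IsConst (suc m ·ᴰ D.1# D.* x) → IsConst x
  isConst-cancel m x mx-const = suc·-cancel m (proj₂ x) (begin
    suc m · proj₂ x                 ≡⟨ proj₂-· (suc m) x ⟨
    proj₂ (suc m ·ᴰ x)              ≈⟨ proj₂ (D.trans (·ᴰ-assoc-* (suc m) D.1# x) (·ᴰ-congʳ (suc m) (D.*-identityˡ x))) ⟨
    proj₂ (suc m ·ᴰ D.1# D.* x)     ≈⟨ mx-const ⟩
    0#                              ∎)
    where
    proj₂-· : ∀ k x → proj₂ (k ·ᴰ x) ≡ k · proj₂ x
    proj₂-· zero    x = ≡.refl
    proj₂-· (suc k) x = ≡.cong (proj₂ x +_) (proj₂-· k x)

  ¬generatedBelow : ∀ {n d} k → k ℕ.+ k ≤ n → d ℕ.< k → ¬ GraphInvariants.GeneratedInDegreeAtMost K n d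
  ¬generatedBelow {n} {d} (suc k) 2k≤n (s≤s d≤k) generated =
    -- The same ε-part is a factorial by direct computation and 0 under the assumed generation.
    factorial-≉0 (suc m) (trans (sym (powerSum-nonConst m<n)) (P-powerSum-doubled
      isConst-isSubring (λ _ → refl) isConst-cancel (point n m) d
      (λ e e≤2d → powerSum-const m<n e (ℕ.≤-trans e≤2d 2d≤m))
      generated (suc k) (powerSum-const m<n (suc k) (ℕ.m≤n+m (suc k) k))))
    where
    open EdgeProduct K dual constᴰ-isHomomorphism n
    -- With the half written as `suc k`, this is twice the half minus one, and `suc m` is
    -- `suc k + suc k` by definition. It bounds both 2d and `suc k`.
    m = k ℕ.+ suc k

    m<n : m ℕ.< n
    m<n = 2k≤n

    2d≤m : d ℕ.* 2 ≤ m
    2d≤m = ℕ.≤-trans (ℕ.*-monoˡ-≤ 2 d≤k) (ℕ.≤-trans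
      (ℕ.≤-reflexive (≡.trans (ℕ.*-comm k 2) (≡.cong (k ℕ.+_) (ℕ.+-identityʳ k))))
      (ℕ.+-monoʳ-≤ k (ℕ.n≤1+n k)))

    factorial-≉0 : ∀ l → ¬ ((l !) · 1# ≈ 0#)
    factorial-≉0 l with l ! | l !≢0
    ... | suc l!-1 | _ = char0 l!-1

corollary8p2 : ∀ {c ℓ₁ ℓ₂ : Level} (K : HeytingField c ℓ₁ ℓ₂) → CharacteristicZero K →
    ∀ (n : ℕ) → .{{_ : NonZero n}} →
    ∀ (β : ℕ) → GraphInvariants.IsBeta K n β → ⌊ n /2⌋ ≤ β
corollary8p2 K char0 n β β-isBeta = ℕ.≮⇒≥ λ β<k →
  ¬generatedBelow K char0 ⌊ n /2⌋ (double-half n) β<k (GraphInvariants.IsBeta.generated β-isBeta)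
  where
  double-half : ∀ n → ⌊ n /2⌋ ℕ.+ ⌊ n /2⌋ ≤ n
  double-half n = ℕ.≤-trans (ℕ.+-monoʳ-≤ ⌊ n /2⌋ (ℕ.⌊n/2⌋≤⌈n/2⌉ n)) (ℕ.≤-reflexive (ℕ.⌊n/2⌋+⌈n/2⌉≡n n))
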